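{- Let $R=(b_1,b_2)$ be a reduced basis of a two-dimensional lattice in $\mathbb{R}^2$ with $|b_1|<|b_2|$ and $m\neq -1/2$, where $m=(b_2,b_1)/(b_1,b_1)$. Let $U\in GL_2(\mathbb{Z})$ and let $\omega_1$ be any decomposition of $U$ in terms of the family of generators $\{S,T\}$ (a word on $\{S,T,T^{ -1}\}$ whose value is $U$). Then the Gaussian decomposition of $U$ (relative to $R$) is obtained from $\omega_1$ by applying repeatedly the following set of rules: (R1) $S^2\longrightarrow 1$; (R2) $T^xT^y\longrightarrow T^{x+y}$; (R3) for all integers $x<0$: $ST^{2}ST^{x}\longrightarrow TST^{ -2}ST^{x+1}$; (R4) for all integers $x>0$: $ST^{ -2}ST^{x}\longrightarrow T^{ -1}ST^{2}ST^{x-1}$; (R5) for all $x\in\mathbb{Z}\setminus\{0\}$ and all integers $k\ge 0$: $ST\,ST^{x}\prod_{i=k}^{1}ST^{y_i}\longrightarrow T\,ST^{ -x-1}\prod_{i=k}^{1}ST^{ -y_i}$; (R6) for all $x\in\mathbb{Z}\setminus\{0\}$ and all integers $k\ge 0$: $ST^{ -1}ST^{x}\prod_{i=k}^{1}ST^{y_i}\longrightarrow T^{ -1}ST^{ -x+1}\prod_{i=k}^{1}ST^{ -y_i}$.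
   Context: Bases: a basis $(b_1,b_2)$ of a two-dimensional lattice in $\mathbb{R}^2$ is identified with the $2\times2$ real matrix whose rows are $b_1,b_2$. $(\cdot,\cdot)$ is the usual scalar product and $|\cdot|$ the Euclidean norm. Put $m=(b_2,b_1)/(b_1,b_1)$. The basis is proper if $-1/2\le m<1/2$, and reduced (Gauss-reduced) if it is proper and $|b_1|\le|b_2|$. Matrices: $S=\begin{pmatrix} 0 & 1 \\ 1 & 0 \end{pmatrix}$, $T=\begin{pmatrix} 1 & 0 \\ 1 & 1 \end{pmatrix}$, so $T^x=\begin{pmatrix} 1 & 0 \\ x & 1 \end{pmatrix}$ for $x\in\mathbb{Z}$. The product $\prod_{i=k}^1 ST^{x_i}$ means $ST^{x_k}ST^{x_{k-1}}\cdots ST^{x_1}$ (empty if $k=0$). Gaussian algorithm: on input a basis $B=(b_1,b_2)$, repeat: replace $b_2$ by $b_2-xb_1$, where $x$ is the integer nearest to $m$, chosen so that the new basis is proper (this replaces $B$ by $T^{ -x}B$); then, if $|b_1|>|b_2|$, swap $b_1$ and $b_2$ (this replaces $B$ by $SB$) and iterate; otherwise stop. The output is a reduced basis. If the successive translation integers are $x_{k+1},x_k,\dots,x_1$ (with a swap between consecutive translations), the execution is recorded by the word $T^{x_{k+1}}ST^{x_k}\cdots ST^{x_2}ST^{x_1}$, and the input equals this product times the output. Gaussian decomposition: given a reduced basis $R$ and $U\in GL_2(\mathbb{Z})$, the Gaussian decomposition of $U$ (relative to $R$) is the word recorded by the Gaussian algorithm when run on the input basis $UR$. Words and rewriting: the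 alphabet is $\Sigma=\{S,T,T^{ -1}\}$ and $1$ denotes the empty word. Rules (R1), (R2) are trivial rules, applied whenever possible, so every word can be written $T^{x_{k+1}}\prod_{i=k}^1ST^{x_i}$ with $x_i\ne0$ for $2\le i\le k$ and $x_1,x_{k+1}\in\mathbb{Z}$; the other rules are applied to words in this form, the displayed powers of $T$ between two letters $S$ (or between the last displayed $S$ and the next $S$ or the end of the word) being the full exponents. In (R5) and (R6) the displayed product runs to the right end of the word. A word is reduced if no rule can be applied to it. "Obtained by applying repeatedly the rules" means that, starting from $\omega_1$, in whatever order the rules are used, the process stops after finitely many steps at a reduced word, which is the asserted word.
   Formalization: Rules (R5) and (R6) are taken for all integers x, including x=0: with x≠0 the word STS is irreducible, yet for R=((1,0),(0,2)) the Gaussian decomposition of its value is TST^{ -1}. In words where the trivial rules no longer apply this adds only the case x=0, k=0. -}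

module Defs where

open import Algebra.Bundles using (CommutativeRing)
open import Algebra.Core using (Op₁; Op₂)
import Algebra.Definitions as AlgebraDefinitions
import Algebra.Definitions.RawMonoid as RawMonoidDefinitions
open import Data.Integer.Base as ℤ using (ℤ; +_; -[1+_]; 0ℤ; 1ℤ; -1ℤ)
open import Data.List.Base using (List; []; _∷_; _++_; foldr; map; replicate)
open import Data.Nat.Base as ℕ using (ℕ; suc)
open import Data.Product.Base using (_×_; _,_; ∃; proj₁; proj₂)
open import Function.Base using (flip)
open import Induction.WellFounded using (Acc)
open import Level using (Level; _⊔_) renaming (suc to lsuc)
open import Relation.Binary.Core using (Rel)
open import Relation.Binary.Construct.Closure.ReflexiveTransitive using (Star)
import Relation.Binary.Construct.NonStrictToStrict as NonStrictToStrict
open import Relation.Binary.PropositionalEquality.Core using (_≡_; _≢_)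
open import Relation.Binary.Rewriting using (IsNormalForm)
open import Relation.Binary.Structures using (IsDecTotalOrder)
open import Relation.Nullary.Negation.Core using (¬_)

-- The library has no real numbers.  ℝ enters only through its arithmetic,
-- its (classically decidable) order and square roots of non-negative numbers,
-- so it is replaced by an arbitrary structure of which ℝ is an instance.
-- _⁻¹ and √ are total functions; they are specified only on x ≉ 0 and 0 ≤ x.

record ArchimedeanEuclideanField c ℓ₁ ℓ₂ : Set (lsuc (c ⊔ ℓ₁ ⊔ ℓ₂)) where
  field
    commutativeRing : CommutativeRing c ℓ₁

  open CommutativeRing commutativeRing public

  open RawMonoidDefinitions +-rawMonoid public
    using () renaming (_×_ to _×ₙ_)

  infix  4 _≤_
  infix  8 _⁻¹

  field
    _≤_             : Rel Carrier ℓ₂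
    isDecTotalOrder : IsDecTotalOrder _≈_ _≤_
    +-monoˡ-≤       : ∀ z {x y} → x ≤ y → x + z ≤ y + z
    *-nonNegative   : ∀ {x y} → 0# ≤ x → 0# ≤ y → 0# ≤ x * y
    0≉1             : ¬ 0# ≈ 1#
    _⁻¹             : Op₁ Carrier
    ⁻¹-inverseʳ     : ∀ {x} → ¬ x ≈ 0# → x * x ⁻¹ ≈ 1#
    √               : Op₁ Carrier
    √-nonNegative   : ∀ {x} → 0# ≤ x → 0# ≤ √ x
    √-square        : ∀ {x} → 0# ≤ x → √ x * √ x ≈ x
    archimedean     : ∀ x → ∃ λ n → x ≤ n ×ₙ 1#

  open NonStrictToStrict _≈_ _≤_ public using (_<_)

  ½ : Carrier
  ½ = (1# + 1#) ⁻¹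

  fromℤ : ℤ → Carrier
  fromℤ (+ n)    = n ×ₙ 1#
  fromℤ -[1+ n ] = - (suc n ×ₙ 1#)

Row : ∀ {a} → Set a → Set a
Row A = A × A

-- 2×2 matrices, as the pair of their rows.
M₂ : ∀ {a} → Set a → Set a
M₂ A = Row A × Row A

matMul : ∀ {a} {A : Set a} → Op₂ A → Op₂ A → Op₂ (M₂ A)
matMul _+_ _*_ ((a , b) , (c , d)) ((p , q) , (r , s)) =
  (((a * p) + (b * r)) , ((a * q) + (b * s))) ,
  (((c * p) + (d * r)) , ((c * q) + (d * s)))

infixr 7 _⊗_

_⊗_ : Op₂ (M₂ ℤ)
_⊗_ = matMul ℤ._+_ ℤ._*_

I₂ : M₂ ℤ
I₂ = (1ℤ , 0ℤ) , (0ℤ , 1ℤ)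

_∈GL₂ℤ : M₂ ℤ → Set
U ∈GL₂ℤ = AlgebraDefinitions.Invertible _≡_ I₂ _⊗_ U

data Letter : Set where
  S T T⁻¹ : Letter

Word : Set
Word = List Letter

letterValue : Letter → M₂ ℤ
letterValue S   = (0ℤ , 1ℤ) , (1ℤ  , 0ℤ)
letterValue T   = (1ℤ , 0ℤ) , (1ℤ  , 1ℤ)
letterValue T⁻¹ = (1ℤ , 0ℤ) , (-1ℤ , 1ℤ)

value : Word → M₂ ℤ
value = foldr (λ l M → letterValue l ⊗ M) I₂

T^ : ℤ → Word
T^ (+ n)    = replicate n T
T^ -[1+ n ] = replicate (suc n) T⁻¹

-- ∏ (xₖ ∷ … ∷ x₁ ∷ []) is the word S T^xₖ ⋯ S T^x₁.
∏ : List ℤ → Word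
∏ []       = []
∏ (x ∷ xs) = S ∷ T^ x ++ ∏ xs

infix 4 _⟶₀_ _⟶_

-- If x and y have the same sign, T^ x ++ T^ y and T^ (x + y) are the same word
-- of letters; the premise of R2 keeps such identities from counting as steps.
data _⟶₀_ : Rel Word Level.zero where
  R1 : ∀ u v → u ++ S ∷ S ∷ v ⟶₀ u ++ v
  R2 : ∀ u x y v → T^ x ++ T^ y ≢ T^ (x ℤ.+ y) →
       u ++ T^ x ++ T^ y ++ v ⟶₀ u ++ T^ (x ℤ.+ y) ++ v

TriviallyReduced : Word → Set
TriviallyReduced = IsNormalForm _⟶₀_

-- TriviallyReduced expresses that R1 and R2 have priority.  Since ∏ ys is empty
-- or starts with S, the exponents displayed to its left are full exponents.
--
-- In a trivially reduced word the exponent x of R5 and R6 can vanish only if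
-- ys is empty.  The published side condition x ≠ 0 also excludes that case, but
-- then S T S is irreducible, although for R = ((1 , 0) , (0 , 2)) the Gaussian
-- decomposition of its value is T S T⁻¹.  Here x ranges over all of ℤ.
data _⟶_ : Rel Word Level.zero where
  trivial : ∀ {w w′} → w ⟶₀ w′ → w ⟶ w′

  R3 : ∀ u x ys → x ℤ.< 0ℤ →
       TriviallyReduced (u ++ ∏ (+ 2 ∷ x ∷ ys)) →
       u ++ ∏ (+ 2 ∷ x ∷ ys) ⟶
       u ++ T^ 1ℤ ++ ∏ (ℤ.- + 2 ∷ x ℤ.+ 1ℤ ∷ ys)

  R4 : ∀ u x ys → 0ℤ ℤ.< x →
       TriviallyReduced (u ++ ∏ (ℤ.- + 2 ∷ x ∷ ys)) →
       u ++ ∏ (ℤ.- + 2 ∷ x ∷ ys) ⟶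
       u ++ T^ -1ℤ ++ ∏ (+ 2 ∷ x ℤ.- 1ℤ ∷ ys)

  R5 : ∀ u x ys →
       TriviallyReduced (u ++ ∏ (1ℤ ∷ x ∷ ys)) →
       u ++ ∏ (1ℤ ∷ x ∷ ys) ⟶
       u ++ T^ 1ℤ ++ ∏ (ℤ.- x ℤ.- 1ℤ ∷ map ℤ.-_ ys)

  R6 : ∀ u x ys →
       TriviallyReduced (u ++ ∏ (-1ℤ ∷ x ∷ ys)) →
       u ++ ∏ (-1ℤ ∷ x ∷ ys) ⟶
       u ++ T^ -1ℤ ++ ∏ (ℤ.- x ℤ.+ 1ℤ ∷ map ℤ.-_ ys)

-- In whatever order the rules are used, rewriting ω stops, and it stops at γ.
record _RewritesTo_ (ω γ : Word) : Set where
  field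
    terminates : Acc (flip _⟶_) ω
    reaches    : Star _⟶_ ω γ
    reduced    : IsNormalForm _⟶_ γ
    unique     : ∀ {w} → Star _⟶_ ω w → IsNormalForm _⟶_ w → w ≡ γ

module Lattice {c ℓ₁ ℓ₂} (F : ArchimedeanEuclideanField c ℓ₁ ℓ₂) where
  open ArchimedeanEuclideanField F

  infixl 7 _·_
  infixr 7 _•_
  infixl 6 _⊖_
  infixr 7 _⊛_

  _·_ : Row Carrier → Row Carrier → Carrier
  (x₁ , x₂) · (y₁ , y₂) = x₁ * y₁ + x₂ * y₂

  ∣_∣ : Row Carrier → Carrier
  ∣ v ∣ = √ (v · v)

  _•_ : Carrier → Row Carrier → Row Carrier
  x • (v₁ , v₂) = x * v₁ , x * v₂

  _⊖_ : Row Carrier → Row Carrier → Row Carrier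
  (u₁ , u₂) ⊖ (v₁ , v₂) = u₁ - v₁ , u₂ - v₂

  _⊛_ : M₂ ℤ → M₂ Carrier → M₂ Carrier
  ((a , b) , (c , d)) ⊛ B =
    matMul _+_ _*_ ((fromℤ a , fromℤ b) , (fromℤ c , fromℤ d)) B

  -- Linear independence over the field: the rows span a two-dimensional lattice.
  IsBasis : M₂ Carrier → Set _
  IsBasis ((p , q) , (r , s)) = ∀ x y →
    x * p + y * r ≈ 0# → x * q + y * s ≈ 0# → x ≈ 0# × y ≈ 0#

  m : M₂ Carrier → Carrier
  m (b₁ , b₂) = (b₂ · b₁) * (b₁ · b₁) ⁻¹

  Proper : M₂ Carrier → Set _
  Proper B = - ½ ≤ m B × m B < ½

  Reduced : M₂ Carrier → Set _
  Reduced B@(b₁ , b₂) = Proper B × ∣ b₁ ∣ ≤ ∣ b₂ ∣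

  -- Executions of the Gaussian algorithm: input, recorded word, output.
  data Execution : M₂ Carrier → Word → M₂ Carrier → Set (c ⊔ ℓ₁ ⊔ ℓ₂) where
    stop : ∀ {b₁ b₂} x →
           let b₂′ = b₂ ⊖ fromℤ x • b₁ in
           Proper (b₁ , b₂′) → ∣ b₁ ∣ ≤ ∣ b₂′ ∣ →
           Execution (b₁ , b₂) (T^ x) (b₁ , b₂′)
    swap : ∀ {b₁ b₂ w R} x →
           let b₂′ = b₂ ⊖ fromℤ x • b₁ in
           Proper (b₁ , b₂′) → ∣ b₂′ ∣ < ∣ b₁ ∣ →
           Execution (b₂′ , b₁) w R →
           Execution (b₁ , b₂) (T^ x ++ S ∷ w) R

  IsGaussianDecomposition : M₂ Carrier → M₂ ℤ → Word → Set _
  IsGaussianDecomposition R U γ = ∃ λ R′ → Execution (U ⊛ R) γ R′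

{-# OPTIONS --safe #-}
module Submission where

-- The Gaussian algorithm only sees the Gram data (p , q , s) = (∣b₁∣² , ∣b₂∣² , 2 (b₁,b₂))
-- of a basis, and a word acts on such triples.  Every rule preserves this action up to
-- s ↦ - s, which keeps the hypotheses on R.  Every rule also lowers a weight, so rewriting
-- stops, and it can only stop at a word T^ x ++ ∏ xs in which all of xs but its last entry
-- has absolute value ≥ 2 and an exponent ± 2 is followed by one of the same sign or by 0.
-- Such a word is what the algorithm records, because each of its letters S T^x turns a
-- basis with ∣m∣ < ½ into a longer one with ∣m∣ < ½.  As the algorithm is deterministic,
-- all normal forms of a word coincide with its Gaussian decomposition.

import Algebra.Properties.AbelianGroup as AbelianGroupProperties
import Algebra.Properties.Ring as RingProperties
import Algebra.Properties.Semiring.Mult as SemiringMult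
import Algebra.Solver.Ring as RingSolver
open import Algebra.Solver.Ring.AlmostCommutativeRing
  using (fromCommutativeRing; _-Raw-AlmostCommutative⟶_)
open import Data.Integer.Base as ℤ using (ℤ; +_; -[1+_]; 0ℤ; 1ℤ; -1ℤ)
import Data.Integer.Properties as ℤ
open import Data.List.Base using (List; []; _∷_; _++_; foldr; length; map; replicate)
open import Data.List.Properties using (++-assoc; ++-identityʳ; foldr-++)
open import Data.List.Relation.Unary.Linked as Linked using (Linked; []; [-]; _∷_)
open import Data.Maybe.Base using (Maybe; just; nothing)
open import Data.Nat.Base as ℕ using (ℕ; zero; suc; z≤n; s≤s)
import Data.Nat.Induction as ℕ
import Data.Nat.Properties as ℕ
import Data.Nat.Tactic.RingSolver as ℕSolver
open import Data.Product.Base using (_×_; _,_; ∃; ∃₂; proj₁; proj₂)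
open import Data.Product.Relation.Binary.Pointwise.NonDependent using (×-setoid)
open import Data.Sum.Base using (_⊎_; inj₁; inj₂)
open import Function.Base using (flip)
open import Induction.WellFounded using (Acc; acc; WellFounded; module Subrelation)
open import Level using (0ℓ; _⊔_)
open import Relation.Binary.Bundles using (Setoid)
open import Relation.Binary.Construct.Closure.ReflexiveTransitive using (Star; ε; _◅_; _◅◅_)
import Relation.Binary.Construct.NonStrictToStrict as NonStrictToStrict
import Relation.Binary.Construct.On as On
open import Relation.Binary.Core using (Rel)
open import Relation.Binary.PropositionalEquality as ≡
  using (_≡_; cong; cong₂; subst; module ≡-Reasoning)
import Relation.Binary.Reasoning.Setoid as SetoidReasoning
open import Relation.Binary.Rewriting using (IsNormalForm)
open import Relation.Binary.Structures using (IsDecTotalOrder)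
open import Relation.Nullary.Decidable.Core using (yes; no)
open import Relation.Nullary.Negation.Core using (¬_; contradiction)
open import Defs

-- Rewriting of words

-- Matrix values are not preserved by the rules, and this is why the proof works with Gram data. The
-- two sides of `R3`, and those of `R4`, differ by the factor -1. For `R5`, S T S = T S T⁻¹ D with D
-- = diag(-1, 1). Since D T^x = T^(-x) D and D S = - S D, moving D to the right negates every later
-- exponent and leaves D, up to sign, as a factor applied to the basis; `R6` behaves in the same
-- way. Gram data do not see the sign, and D acts on them as s ↦ - s. This also explains why the
-- last two rules must rewrite the whole remainder of the word. The exponents ± 2 are delicate:
-- whether S T^2 lengthens a basis depends on the sign of the scalar product, so the induction along
-- a word has to carry the sign of the preceding exponent as well.

data Compatible : Rel Letter 0ℓ where
  S-T     : Compatible S T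
  S-T⁻¹   : Compatible S T⁻¹
  T-S     : Compatible T S
  T-T     : Compatible T T
  T⁻¹-S   : Compatible T⁻¹ S
  T⁻¹-T⁻¹ : Compatible T⁻¹ T⁻¹

replicate-+ : ∀ {A : Set} {a : A} m n → replicate (m ℕ.+ n) a ≡ replicate m a ++ replicate n a
replicate-+ zero    n = ≡.refl
replicate-+ (suc m) n = cong (_ ∷_) (replicate-+ m n)

-- Exactly the pairs of exponents for which `R2` is a genuine step: in all other cases the
-- concatenation already is the letter word of the sum.
data OppositeSigns : Rel ℤ 0ℓ where
  +- : ∀ m n → OppositeSigns (+ suc m) -[1+ n ]
  -+ : ∀ m n → OppositeSigns -[1+ m ] (+ suc n)

T^-++ : ∀ x y → T^ x ++ T^ y ≡ T^ (x ℤ.+ y) ⊎ OppositeSigns x y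
T^-++ (+ m)       (+ n)       = inj₁ (≡.sym (replicate-+ m n))
T^-++ (+ zero)    -[1+ n ]    = inj₁ ≡.refl
T^-++ (+ suc m)   -[1+ n ]    = inj₂ (+- m n)
T^-++ -[1+ m ]    (+ zero)    = inj₁ (++-identityʳ (T^ -[1+ m ]))
T^-++ -[1+ m ]    (+ suc n)   = inj₂ (-+ m n)
T^-++ -[1+ m ]    -[1+ n ]    = inj₁ (begin
  replicate (suc m) T⁻¹ ++ replicate (suc n) T⁻¹ ≡⟨ replicate-+ (suc m) (suc n) ⟨
  replicate (suc m ℕ.+ suc n) T⁻¹
    ≡⟨ cong (λ k → replicate (suc k) T⁻¹) (ℕ.+-suc m n) ⟩
  T^ (-[1+ m ] ℤ.+ -[1+ n ])                      ∎)
  where open ≡-Reasoning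

linked-++⁻ʳ : ∀ u {v} → Linked Compatible (u ++ v) → Linked Compatible v
linked-++⁻ʳ []      l = l
linked-++⁻ʳ (_ ∷ u) l = linked-++⁻ʳ u (Linked.tail l)

¬linked-junction : ∀ {a b} → ¬ Compatible a b → ∀ m v →
  ¬ Linked Compatible (a ∷ replicate m a ++ b ∷ v)
¬linked-junction ¬ab zero    v (ab ∷ _) = ¬ab ab
¬linked-junction ¬ab (suc m) v (_ ∷ l)  = ¬linked-junction ¬ab m v l

linked⇒triviallyReduced : ∀ {w} → Linked Compatible w → TriviallyReduced w
linked⇒triviallyReduced l (_ , R1 u v) with linked-++⁻ʳ u l
... | () ∷ _
linked⇒triviallyReduced l (_ , R2 u x y v x+y≢) with T^-++ x y
... | inj₁ x+y≡   = x+y≢ x+y≡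
... | inj₂ (+- m n) = ¬linked-junction (λ ()) m _ (linked-++⁻ʳ u l)
... | inj₂ (-+ m n) = ¬linked-junction (λ ()) m _ (linked-++⁻ʳ u l)

compatible⊎cancels : ∀ a b → Compatible a b ⊎ (∀ w → ∃ λ w′ → a ∷ b ∷ w ⟶₀ w′)
compatible⊎cancels S   S   = inj₂ λ w → _ , R1 [] w
compatible⊎cancels S   T   = inj₁ S-T
compatible⊎cancels S   T⁻¹ = inj₁ S-T⁻¹
compatible⊎cancels T   S   = inj₁ T-S
compatible⊎cancels T   T   = inj₁ T-T
compatible⊎cancels T   T⁻¹ = inj₂ λ w → _ , R2 [] 1ℤ -1ℤ w λ ()
compatible⊎cancels T⁻¹ S   = inj₁ T⁻¹-S
compatible⊎cancels T⁻¹ T   = inj₂ λ w → _ , R2 [] -1ℤ 1ℤ w λ ()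
compatible⊎cancels T⁻¹ T⁻¹ = inj₁ T⁻¹-T⁻¹

∷-⟶₀ : ∀ a {w w′} → w ⟶₀ w′ → a ∷ w ⟶₀ a ∷ w′
∷-⟶₀ a (R1 u v)          = R1 (a ∷ u) v
∷-⟶₀ a (R2 u x y v x+y≢) = R2 (a ∷ u) x y v x+y≢

linked⊎⟶₀ : ∀ w → Linked Compatible w ⊎ ∃ λ w′ → w ⟶₀ w′
linked⊎⟶₀ []          = inj₁ []
linked⊎⟶₀ (a ∷ [])    = inj₁ [-]
linked⊎⟶₀ (a ∷ b ∷ w) with linked⊎⟶₀ (b ∷ w)
... | inj₂ (_ , step) = inj₂ (_ , ∷-⟶₀ a step)
... | inj₁ l with compatible⊎cancels a b
...   | inj₁ ab      = inj₁ (ab ∷ l)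
...   | inj₂ cancels = inj₂ (cancels w)

linked⇒T^∏ : ∀ w → Linked Compatible w → ∃₂ λ x xs → w ≡ T^ x ++ ∏ xs
linked⇒T^∏ []        l = 0ℤ , [] , ≡.refl
linked⇒T^∏ (S ∷ w)   l with linked⇒T^∏ w (Linked.tail l)
... | y , ys , ≡.refl = 0ℤ , y ∷ ys , ≡.refl
linked⇒T^∏ (T ∷ w)   l with linked⇒T^∏ w (Linked.tail l)
linked⇒T^∏ (T ∷ w) l        | + n , ys , ≡.refl = + suc n , ys , ≡.refl
linked⇒T^∏ (T ∷ w) (() ∷ _) | -[1+ n ] , ys , ≡.refl
linked⇒T^∏ (T⁻¹ ∷ w) l with linked⇒T^∏ w (Linked.tail l)
linked⇒T^∏ (T⁻¹ ∷ w) l        | + zero , ys , ≡.refl = -1ℤ , ys , ≡.refl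
linked⇒T^∏ (T⁻¹ ∷ w) (() ∷ _) | + suc n , ys , ≡.refl
linked⇒T^∏ (T⁻¹ ∷ w) l        | -[1+ n ] , ys , ≡.refl = -[1+ suc n ] , ys , ≡.refl

-- Exponent patterns that avoid the rules.

data Admissible : Rel ℤ 0ℓ where
  ≥3  : ∀ {y} n → Admissible (+ (3 ℕ.+ n)) y
  ≤-3 : ∀ {y} n → Admissible -[1+ 2 ℕ.+ n ] y
  =2  : ∀ {y} → 0ℤ ℤ.≤ y → Admissible (+ 2) y
  =-2 : ∀ {y} → y ℤ.≤ 0ℤ → Admissible -[1+ 1 ] y

-- Excluded pairs are the left-hand sides of rules: a first exponent 0 exposes `R1`, ± 1 exposes
-- `R5` or `R6`, and ± 2 before an exponent of opposite sign exposes `R3` or `R4`. The last exponent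
-- is free, because each of these rules needs a further letter `S` to its right.
Gaussian : List ℤ → Set
Gaussian = Linked Admissible

Reducible : Word → Set
Reducible w = ∃ λ w′ → w ⟶ w′

admissible⊎reducible : ∀ x y → Admissible x y ⊎
  (∀ u ys → TriviallyReduced (u ++ ∏ (x ∷ y ∷ ys)) → Reducible (u ++ ∏ (x ∷ y ∷ ys)))
admissible⊎reducible (+ 0) y = inj₂ λ u ys tr → contradiction (_ , R1 u _) tr
admissible⊎reducible (+ 1) y = inj₂ λ u ys tr → _ , R5 u y ys tr
admissible⊎reducible (+ 2) (+ n) = inj₁ (=2 (ℤ.+≤+ z≤n))
admissible⊎reducible (+ 2) -[1+ n ] = inj₂ λ u ys tr → _ , R3 u -[1+ n ] ys ℤ.-<+ tr
admissible⊎reducible (+ suc (suc (suc n))) y = inj₁ (≥3 n)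
admissible⊎reducible -[1+ 0 ] y = inj₂ λ u ys tr → _ , R6 u y ys tr
admissible⊎reducible -[1+ 1 ] (+ 0) = inj₁ (=-2 (ℤ.+≤+ z≤n))
admissible⊎reducible -[1+ 1 ] (+ suc n) = inj₂ λ u ys tr → _ , R4 u (+ suc n) ys (ℤ.+<+ ℕ.z<s) tr
admissible⊎reducible -[1+ 1 ] -[1+ n ] = inj₁ (=-2 ℤ.-≤+)
admissible⊎reducible -[1+ suc (suc n) ] y = inj₁ (≤-3 n)

-- The prefix `u` is quantified so that a redex found further right can absorb `S ∷ T^ x` into it.
-- The tail needs no such freedom, since every rule other than the trivial ones rewrites up to the
-- right end.
gaussian⊎reducible : ∀ xs → Gaussian xs ⊎
  (∀ u → TriviallyReduced (u ++ ∏ xs) → Reducible (u ++ ∏ xs))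
gaussian⊎reducible []           = inj₁ []
gaussian⊎reducible (x ∷ [])     = inj₁ [-]
gaussian⊎reducible (x ∷ y ∷ ys) with gaussian⊎reducible (y ∷ ys)
... | inj₂ red = inj₂ λ u →
  subst (λ w → TriviallyReduced w → Reducible w) (++-assoc u (S ∷ T^ x) (∏ (y ∷ ys)))
        (red (u ++ S ∷ T^ x))
... | inj₁ g with admissible⊎reducible x y
...   | inj₁ xy  = inj₁ (xy ∷ g)
...   | inj₂ red = inj₂ λ u → red u ys

progress : ∀ w → Reducible w ⊎ ∃₂ λ x xs → Gaussian xs × w ≡ T^ x ++ ∏ xs
progress w with linked⊎⟶₀ w
... | inj₂ (_ , step) = inj₁ (_ , trivial step)
... | inj₁ l with linked⇒T^∏ w l
...   | x , xs , ≡.refl with gaussian⊎reducible xs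
...     | inj₁ g   = inj₂ (x , xs , g , ≡.refl)
...     | inj₂ red = inj₁ (red (T^ x) (linked⇒triviallyReduced l))

-- The sum over all letters of 1 + the number of letters S to its left.  R3 and R4 move a
-- letter T^±1 two such letters to the left, and R5 and R6 remove a letter S.
weight : Word → ℕ
weight []        = 0
weight (S ∷ w)   = suc (length w ℕ.+ weight w)
weight (T ∷ w)   = suc (weight w)
weight (T⁻¹ ∷ w) = suc (weight w)

-- The length is included because prefixing a letter S adds it to the weight.
infix 4 _⊏_

_⊏_ : Rel Word 0ℓ
w′ ⊏ w = length w′ ℕ.≤ length w × weight w′ ℕ.< weight w

⊏-++ : ∀ u {w w′} → w′ ⊏ w → u ++ w′ ⊏ u ++ w
⊏-++ []        lt = lt
⊏-++ (S ∷ u)   lt with ⊏-++ u lt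
... | l , μ = s≤s l , s≤s (ℕ.+-mono-≤-< l μ)
⊏-++ (T ∷ u)   lt with ⊏-++ u lt
... | l , μ = s≤s l , s≤s μ
⊏-++ (T⁻¹ ∷ u) lt with ⊏-++ u lt
... | l , μ = s≤s l , s≤s μ

-- Decrease of the weight under each rule.

length-T^ : ∀ x v → length (T^ x ++ v) ≡ ℤ.∣ x ∣ ℕ.+ length v
length-T^ (+ zero)      v = ≡.refl
length-T^ (+ suc n)     v = cong suc (length-T^ (+ n) v)
length-T^ -[1+ zero ]   v = ≡.refl
length-T^ -[1+ suc n ]  v = cong suc (length-T^ -[1+ n ] v)

weight-T^ : ∀ x v → weight (T^ x ++ v) ≡ ℤ.∣ x ∣ ℕ.+ weight v
weight-T^ (+ zero)      v = ≡.refl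
weight-T^ (+ suc n)     v = cong suc (weight-T^ (+ n) v)
weight-T^ -[1+ zero ]   v = ≡.refl
weight-T^ -[1+ suc n ]  v = cong suc (weight-T^ -[1+ n ] v)

length-∏-neg : ∀ xs → length (∏ (map ℤ.-_ xs)) ≡ length (∏ xs)
length-∏-neg []       = ≡.refl
length-∏-neg (x ∷ xs)
  rewrite length-T^ (ℤ.- x) (∏ (map ℤ.-_ xs)) | length-T^ x (∏ xs)
        | ℤ.∣-i∣≡∣i∣ x | length-∏-neg xs = ≡.refl

weight-∏-neg : ∀ xs → weight (∏ (map ℤ.-_ xs)) ≡ weight (∏ xs)
weight-∏-neg []       = ≡.refl
weight-∏-neg (x ∷ xs)
  rewrite length-T^ (ℤ.- x) (∏ (map ℤ.-_ xs)) | length-T^ x (∏ xs)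
        | weight-T^ (ℤ.- x) (∏ (map ℤ.-_ xs)) | weight-T^ x (∏ xs)
        | ℤ.∣-i∣≡∣i∣ x | length-∏-neg xs | weight-∏-neg xs = ≡.refl

∣i+j∣<∣i∣+∣j∣ : ∀ {x y} → OppositeSigns x y → ℤ.∣ x ℤ.+ y ∣ ℕ.< ℤ.∣ x ∣ ℕ.+ ℤ.∣ y ∣
∣i+j∣<∣i∣+∣j∣ (+- m n) = s≤s (begin
  ℤ.∣ suc m ℤ.⊖ suc n ∣ ≡⟨ cong ℤ.∣_∣ (ℤ.[1+m]⊖[1+n]≡m⊖n m n) ⟩
  ℤ.∣ m ℤ.⊖ n ∣         ≤⟨ ℤ.∣m⊝n∣≤m⊔n m n ⟩
  m ℕ.⊔ n             ≤⟨ ℕ.m⊔n≤m+n m n ⟩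
  m ℕ.+ n             ≤⟨ ℕ.+-monoʳ-≤ m (ℕ.n≤1+n n) ⟩
  m ℕ.+ suc n         ∎)
  where open ℕ.≤-Reasoning
∣i+j∣<∣i∣+∣j∣ (-+ m n) = s≤s (begin
  ℤ.∣ suc n ℤ.⊖ suc m ∣ ≡⟨ cong ℤ.∣_∣ (ℤ.[1+m]⊖[1+n]≡m⊖n n m) ⟩
  ℤ.∣ n ℤ.⊖ m ∣         ≤⟨ ℤ.∣m⊝n∣≤m⊔n n m ⟩
  n ℕ.⊔ m             ≤⟨ ℕ.m⊔n≤m+n n m ⟩
  n ℕ.+ m             ≡⟨ ℕ.+-comm n m ⟩
  m ℕ.+ n             ≤⟨ ℕ.+-monoʳ-≤ m (ℕ.n≤1+n n) ⟩
  m ℕ.+ suc n         ∎)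
  where open ℕ.≤-Reasoning

-- Only absolute values enter the weight, so one statement serves `R3` and `R4`. The length stays
-- the same, and one letter passes two letters `S`, so the weight drops by exactly 2.
⊏-R3 : ∀ a x f b y ys → ℤ.∣ x ∣ ≡ suc ℤ.∣ y ∣ → ℤ.∣ a ∣ ≡ ℤ.∣ b ∣ → ℤ.∣ f ∣ ≡ 1 →
       T^ f ++ ∏ (b ∷ y ∷ ys) ⊏ ∏ (a ∷ x ∷ ys)
⊏-R3 a x f b y ys ∣x∣≡ ∣a∣≡ ∣f∣≡
  rewrite length-T^ f (∏ (b ∷ y ∷ ys)) | weight-T^ f (∏ (b ∷ y ∷ ys))
        | length-T^ b (∏ (y ∷ ys)) | weight-T^ b (∏ (y ∷ ys))
        | length-T^ a (∏ (x ∷ ys)) | weight-T^ a (∏ (x ∷ ys))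
        | length-T^ y (∏ ys) | weight-T^ y (∏ ys)
        | length-T^ x (∏ ys) | weight-T^ x (∏ ys)
        | ∣x∣≡ | ∣a∣≡ | ∣f∣≡
        = ℕ.≤-reflexive (eq₁ ℤ.∣ b ∣ ℤ.∣ y ∣ (length (∏ ys)))
        , ℕ.≤-trans (ℕ.m≤m+n _ 1)
            (ℕ.≤-reflexive (eq₂ ℤ.∣ b ∣ ℤ.∣ y ∣ (length (∏ ys)) (weight (∏ ys))))
  where
  eq₁ : ∀ b y l → suc (suc (b ℕ.+ suc (y ℕ.+ l))) ≡ suc (b ℕ.+ suc (suc y ℕ.+ l))
  eq₁ = ℕSolver.solve-∀
  eq₂ : ∀ b y l μ →
        suc (suc (suc (b ℕ.+ suc (y ℕ.+ l) ℕ.+ (b ℕ.+ suc (y ℕ.+ l ℕ.+ (y ℕ.+ μ)))))) ℕ.+ 1 ≡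
        suc (b ℕ.+ suc (suc y ℕ.+ l) ℕ.+ (b ℕ.+ suc (suc y ℕ.+ l ℕ.+ (suc y ℕ.+ μ))))
  eq₂ = ℕSolver.solve-∀

-- Serves `R5` and `R6`. The new exponent may exceed the old one by 1 in absolute value, but the
-- lost letter `S` pays for it: it stood to the left of all letters of `T^ x ++ ∏ ys`. Negating the
-- exponents of the tail changes neither length nor weight.
⊏-R5 : ∀ a x f y ys → ℤ.∣ y ∣ ℕ.≤ suc ℤ.∣ x ∣ → ℤ.∣ a ∣ ≡ 1 → ℤ.∣ f ∣ ≡ 1 →
       T^ f ++ ∏ (y ∷ map ℤ.-_ ys) ⊏ ∏ (a ∷ x ∷ ys)
⊏-R5 a x f y ys ∣y∣≤ ∣a∣≡ ∣f∣≡
  rewrite length-T^ f (∏ (y ∷ map ℤ.-_ ys)) | weight-T^ f (∏ (y ∷ map ℤ.-_ ys))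
        | length-T^ a (∏ (x ∷ ys)) | weight-T^ a (∏ (x ∷ ys))
        | length-T^ y (∏ (map ℤ.-_ ys)) | weight-T^ y (∏ (map ℤ.-_ ys))
        | length-T^ x (∏ ys) | weight-T^ x (∏ ys)
        | length-∏-neg ys | weight-∏-neg ys
        | ∣a∣≡ | ∣f∣≡
        = s≤s (s≤s (ℕ.+-monoˡ-≤ _ ∣y∣≤))
        , ℕ.≤-trans (s≤s (s≤s (s≤s (ℕ.+-mono-≤ (ℕ.+-monoˡ-≤ l ∣y∣≤) (ℕ.+-monoˡ-≤ μ ∣y∣≤)))))
            (ℕ.≤-trans (ℕ.m≤m+n _ (ℤ.∣ x ∣ ℕ.+ l))
                       (ℕ.≤-reflexive (eq ℤ.∣ x ∣ l μ)))
  where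
  l μ : ℕ
  l = length (∏ ys)
  μ = weight (∏ ys)
  eq : ∀ x l μ → suc (suc (suc (suc x ℕ.+ l ℕ.+ (suc x ℕ.+ μ)))) ℕ.+ (x ℕ.+ l) ≡
       suc (1 ℕ.+ suc (x ℕ.+ l) ℕ.+ (1 ℕ.+ suc (x ℕ.+ l ℕ.+ (x ℕ.+ μ))))
  eq = ℕSolver.solve-∀

⟶₀⇒⊏ : ∀ {w w′} → w ⟶₀ w′ → w′ ⊏ w
⟶₀⇒⊏ (R1 u v) = ⊏-++ u
  ( ℕ.m≤n+m (length v) 2
  , s≤s (ℕ.≤-trans (ℕ.m≤n+m (weight v) (length v))
          (ℕ.≤-trans (ℕ.n≤1+n _) (ℕ.m≤n+m _ (suc (length v))))) )
⟶₀⇒⊏ (R2 u x y v x+y≢) with T^-++ x y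
... | inj₁ x+y≡ = contradiction x+y≡ x+y≢
... | inj₂ opp = ⊏-++ u shorter
  where
  shorter : T^ (x ℤ.+ y) ++ v ⊏ T^ x ++ T^ y ++ v
  shorter
    rewrite length-T^ (x ℤ.+ y) v | length-T^ x (T^ y ++ v) | length-T^ y v
          | weight-T^ (x ℤ.+ y) v | weight-T^ x (T^ y ++ v) | weight-T^ y v
          | ≡.sym (ℕ.+-assoc ℤ.∣ x ∣ ℤ.∣ y ∣ (length v))
          | ≡.sym (ℕ.+-assoc ℤ.∣ x ∣ ℤ.∣ y ∣ (weight v))
    = ℕ.+-monoˡ-≤ _ (ℕ.<⇒≤ (∣i+j∣<∣i∣+∣j∣ opp))
    , ℕ.+-monoˡ-< _ (∣i+j∣<∣i∣+∣j∣ opp)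

∣-i+j∣≤1+∣i∣ : ∀ i j → ℤ.∣ j ∣ ≡ 1 → ℤ.∣ ℤ.- i ℤ.+ j ∣ ℕ.≤ suc ℤ.∣ i ∣
∣-i+j∣≤1+∣i∣ i j ∣j∣≡1 = begin
  ℤ.∣ ℤ.- i ℤ.+ j ∣       ≤⟨ ℤ.∣i+j∣≤∣i∣+∣j∣ (ℤ.- i) j ⟩
  ℤ.∣ ℤ.- i ∣ ℕ.+ ℤ.∣ j ∣   ≡⟨ cong₂ ℕ._+_ (ℤ.∣-i∣≡∣i∣ i) ∣j∣≡1 ⟩
  ℤ.∣ i ∣ ℕ.+ 1           ≡⟨ ℕ.+-comm ℤ.∣ i ∣ 1 ⟩
  suc ℤ.∣ i ∣             ∎
  where open ℕ.≤-Reasoning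

⟶⇒⊏ : ∀ {w w′} → w ⟶ w′ → w′ ⊏ w
⟶⇒⊏ (trivial step)          = ⟶₀⇒⊏ step
⟶⇒⊏ (R3 u -[1+ n ] ys _ _) = ⊏-++ u
  (⊏-R3 (+ 2) -[1+ n ] 1ℤ -[1+ 1 ] (-[1+ n ] ℤ.+ 1ℤ) ys
    (cong suc (≡.sym (∣1⊖1+n∣≡n n))) ≡.refl ≡.refl)
  where
  ∣1⊖1+n∣≡n : ∀ n → ℤ.∣ 1 ℤ.⊖ suc n ∣ ≡ n
  ∣1⊖1+n∣≡n zero    = ≡.refl
  ∣1⊖1+n∣≡n (suc n) = ≡.refl
⟶⇒⊏ (R3 u (+ n) ys (ℤ.+<+ ()) _)
⟶⇒⊏ (R4 u (+ suc n) ys _ _) = ⊏-++ u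
  (⊏-R3 -[1+ 1 ] (+ suc n) -1ℤ (+ 2) (+ n) ys ≡.refl ≡.refl ≡.refl)
⟶⇒⊏ (R4 u (+ zero) ys (ℤ.+<+ ()) _)
⟶⇒⊏ (R5 u x ys _) = ⊏-++ u
  (⊏-R5 1ℤ x 1ℤ (ℤ.- x ℤ.- 1ℤ) ys (∣-i+j∣≤1+∣i∣ x -1ℤ ≡.refl) ≡.refl ≡.refl)
⟶⇒⊏ (R6 u x ys _) = ⊏-++ u
  (⊏-R5 -1ℤ x -1ℤ (ℤ.- x ℤ.+ 1ℤ) ys (∣-i+j∣≤1+∣i∣ x 1ℤ ≡.refl) ≡.refl ≡.refl)

⟶-wellFounded : WellFounded (flip _⟶_)
⟶-wellFounded = Subrelation.wellFounded (λ step → proj₂ (⟶⇒⊏ step))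
  (On.wellFounded weight ℕ.<-wellFounded)

-- Arithmetic and order of the field

module FieldProperties {c ℓ₁ ℓ₂} (F : ArchimedeanEuclideanField c ℓ₁ ℓ₂) where
  open ArchimedeanEuclideanField F
  open IsDecTotalOrder isDecTotalOrder public
    using (total; antisym; _≟_; ≤-respʳ-≈; ≤-respˡ-≈)
    renaming (refl to ≤-refl; reflexive to ≤-reflexive; trans to ≤-trans)
  open RingProperties ring public using (-‿distribˡ-*; -‿distribʳ-*; -‿involutive; -0#≈0#)
  open AbelianGroupProperties +-abelianGroup
    using (x∙y⁻¹≈ε⇒x≈y; xyx⁻¹≈y) renaming (⁻¹-∙-comm to -‿+-comm)
  open SemiringMult semiring using (×-homo-+; ×1-homo-*)
  open SetoidReasoning setoid

  fromℤ-neg : ∀ i → fromℤ (ℤ.- i) ≈ - fromℤ i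
  fromℤ-neg (+ zero)  = sym -0#≈0#
  fromℤ-neg (+ suc n) = refl
  fromℤ-neg -[1+ n ]  = sym (-‿involutive _)

  fromℤ-⊖ : ∀ m n → fromℤ (m ℤ.⊖ n) ≈ fromℤ (+ m) - fromℤ (+ n)
  fromℤ-⊖ m       zero    = sym (trans (+-congˡ -0#≈0#) (+-identityʳ _))
  fromℤ-⊖ zero    (suc n) = sym (+-identityˡ _)
  fromℤ-⊖ (suc m) (suc n) = begin
    fromℤ (suc m ℤ.⊖ suc n)                       ≡⟨ cong fromℤ (ℤ.[1+m]⊖[1+n]≡m⊖n m n) ⟩
    fromℤ (m ℤ.⊖ n)                               ≈⟨ fromℤ-⊖ m n ⟩
    fromℤ (+ m) - fromℤ (+ n)                     ≈⟨ +-congʳ (xyx⁻¹≈y 1# _) ⟨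
    1# + fromℤ (+ m) - 1# - fromℤ (+ n)           ≈⟨ +-assoc _ _ _ ⟩
    1# + fromℤ (+ m) + (- 1# - fromℤ (+ n))       ≈⟨ +-congˡ (-‿+-comm _ _) ⟩
    1# + fromℤ (+ m) - (1# + fromℤ (+ n))         ∎

  fromℤ-+ : ∀ i j → fromℤ (i ℤ.+ j) ≈ fromℤ i + fromℤ j
  fromℤ-+ (+ m)    (+ n)    = ×-homo-+ 1# m n
  fromℤ-+ (+ m)    -[1+ n ] = fromℤ-⊖ m (suc n)
  fromℤ-+ -[1+ m ] (+ n)    = trans (fromℤ-⊖ n (suc m)) (+-comm _ _)
  fromℤ-+ -[1+ m ] -[1+ n ] = begin
    fromℤ -[1+ suc (m ℕ.+ n) ]              ≡⟨ cong fromℤ (ℤ.neg-distrib-+ (+ suc m) (+ suc n)) ⟨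
    fromℤ (ℤ.- (+ suc m ℤ.+ + suc n))       ≈⟨ fromℤ-neg (+ suc m ℤ.+ + suc n) ⟩
    - fromℤ (+ suc m ℤ.+ + suc n)           ≈⟨ -‿cong (×-homo-+ 1# (suc m) (suc n)) ⟩
    - (fromℤ (+ suc m) + fromℤ (+ suc n))   ≈⟨ -‿+-comm _ _ ⟨
    fromℤ -[1+ m ] + fromℤ -[1+ n ]         ∎

  fromℤ-+* : ∀ m j → fromℤ (+ m ℤ.* j) ≈ fromℤ (+ m) * fromℤ j
  fromℤ-+* m (+ n) = begin
    fromℤ (+ m ℤ.* + n)       ≡⟨ cong fromℤ (ℤ.pos-* m n) ⟨
    fromℤ (+ (m ℕ.* n))       ≈⟨ ×1-homo-* m n ⟩
    fromℤ (+ m) * fromℤ (+ n) ∎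
  fromℤ-+* m -[1+ n ] = begin
    fromℤ (+ m ℤ.* -[1+ n ])          ≡⟨ cong fromℤ (ℤ.neg-distribʳ-* (+ m) (+ suc n)) ⟨
    fromℤ (ℤ.- (+ m ℤ.* + suc n))     ≈⟨ fromℤ-neg (+ m ℤ.* + suc n) ⟩
    - fromℤ (+ m ℤ.* + suc n)         ≈⟨ -‿cong (fromℤ-+* m (+ suc n)) ⟩
    - (fromℤ (+ m) * fromℤ (+ suc n)) ≈⟨ -‿distribʳ-* _ _ ⟩
    fromℤ (+ m) * fromℤ -[1+ n ]      ∎

  fromℤ-* : ∀ i j → fromℤ (i ℤ.* j) ≈ fromℤ i * fromℤ j
  fromℤ-* (+ m)    j = fromℤ-+* m j
  fromℤ-* -[1+ m ] j = begin
    fromℤ (-[1+ m ] ℤ.* j)        ≡⟨ cong fromℤ (ℤ.neg-distribˡ-* (+ suc m) j) ⟨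
    fromℤ (ℤ.- (+ suc m ℤ.* j))   ≈⟨ fromℤ-neg (+ suc m ℤ.* j) ⟩
    - fromℤ (+ suc m ℤ.* j)       ≈⟨ -‿cong (fromℤ-+* (suc m) j) ⟩
    - (fromℤ (+ suc m) * fromℤ j) ≈⟨ -‿distribˡ-* _ _ ⟩
    fromℤ -[1+ m ] * fromℤ j      ∎

  -- Gives the ring solver coefficients in ℤ, so that the exponents ± 1 and ± 2 of the rules can
  -- appear as constants in polynomial identities.
  fromℤ-homomorphism : ℤ.+-*-rawRing -Raw-AlmostCommutative⟶ fromCommutativeRing commutativeRing
  fromℤ-homomorphism = record
    { ⟦_⟧    = fromℤ
    ; +-homo = fromℤ-+
    ; *-homo = fromℤ-*
    ; -‿homo = fromℤ-neg
    ; 0-homo = refl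
    ; 1-homo = +-identityʳ 1#
    }

  fromℤ-≟ : ∀ i j → Maybe (fromℤ i ≈ fromℤ j)
  fromℤ-≟ i j with i ℤ.≟ j
  ... | yes i≡j = just (reflexive (cong fromℤ i≡j))
  ... | no _    = nothing

  open RingSolver ℤ.+-*-rawRing (fromCommutativeRing commutativeRing)
    fromℤ-homomorphism fromℤ-≟ public
    using (Polynomial; solve; con; _:=_; _:+_; _:*_; _:-_; :-_)

  module < = NonStrictToStrict _≈_ _≤_

  <⇒≱ : ∀ {x y} → x < y → ¬ y ≤ x
  <⇒≱ = <.<⇒≱ antisym

  ≰⇒> : ∀ {x y} → ¬ x ≤ y → y < x
  ≰⇒> = <.≰⇒> sym ≤-reflexive total

  <-respʳ-≈ : ∀ {x y z} → y ≈ z → x < y → x < z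
  <-respʳ-≈ = <.<-respʳ-≈ sym trans ≤-respʳ-≈

  x≤y⇒0≤y-x : ∀ {x y} → x ≤ y → 0# ≤ y - x
  x≤y⇒0≤y-x {x} x≤y = ≤-respˡ-≈ (-‿inverseʳ x) (+-monoˡ-≤ (- x) x≤y)

  0≤y-x⇒x≤y : ∀ {x y} → 0# ≤ y - x → x ≤ y
  0≤y-x⇒x≤y {x} {y} 0≤ = ≤-respˡ-≈ (+-identityˡ x)
    (≤-respʳ-≈ (solve 2 (λ x y → y :- x :+ x := y) refl x y) (+-monoˡ-≤ x 0≤))

  x<y⇒0<y-x : ∀ {x y} → x < y → 0# < y - x
  x<y⇒0<y-x {x} {y} (x≤y , x≉y) = x≤y⇒0≤y-x x≤y ,
    λ 0≈y-x → x≉y (sym (x∙y⁻¹≈ε⇒x≈y y x (sym 0≈y-x)))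

  0<y-x⇒x<y : ∀ {x y} → 0# < y - x → x < y
  0<y-x⇒x<y {x} 0< = 0≤y-x⇒x≤y (proj₁ 0<) , λ x≈y →
    proj₂ 0< (trans (sym (-‿inverseʳ x)) (+-congʳ x≈y))

  0≤+0≤ : ∀ {x y} → 0# ≤ x → 0# ≤ y → 0# ≤ x + y
  0≤+0≤ {x} {y} 0≤x 0≤y = ≤-trans 0≤y (≤-respˡ-≈ (+-identityˡ y) (+-monoˡ-≤ y 0≤x))

  0<+0≤ : ∀ {x y} → 0# < x → 0# ≤ y → 0# < x + y
  0<+0≤ {x} {y} 0<x 0≤y = 0≤+0≤ (proj₁ 0<x) 0≤y , λ 0≈ → <⇒≱ 0<x
    (≤-respˡ-≈ (+-identityˡ x) (≤-respʳ-≈ (trans (+-comm y x) (sym 0≈)) (+-monoˡ-≤ x 0≤y)))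

  0<+0< : ∀ {x y} → 0# < x → 0# < y → 0# < x + y
  0<+0< 0<x 0<y = 0<+0≤ 0<x (proj₁ 0<y)

  -- The axioms speak of ≤ only; that the product does not vanish comes from multiplying by the
  -- inverse of `x`.
  0<*0< : ∀ {x y} → 0# < x → 0# < y → 0# < x * y
  0<*0< {x} {y} (0≤x , 0≉x) (0≤y , 0≉y) = *-nonNegative 0≤x 0≤y , λ 0≈xy → 0≉y (begin
    0#               ≈⟨ zeroʳ (x ⁻¹) ⟨
    x ⁻¹ * 0#        ≈⟨ *-congˡ 0≈xy ⟩
    x ⁻¹ * (x * y)   ≈⟨ solve 3 (λ x i y → i :* (x :* y) := (x :* i) :* y) refl x (x ⁻¹) y ⟩
    x * x ⁻¹ * y     ≈⟨ *-congʳ (⁻¹-inverseʳ (λ x≈0 → 0≉x (sym x≈0))) ⟩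
    1# * y           ≈⟨ *-identityˡ y ⟩
    y                ∎)

  ¬0<x∧0≤-x : ∀ {x} → 0# < x → ¬ 0# ≤ - x
  ¬0<x∧0≤-x {x} 0<x 0≤-x = proj₂ (0<+0≤ 0<x 0≤-x) (sym (-‿inverseʳ x))

  ≤0⇒0≤- : ∀ {x} → x ≤ 0# → 0# ≤ - x
  ≤0⇒0≤- x≤0 = ≤-respʳ-≈ (+-identityˡ _) (x≤y⇒0≤y-x x≤0)

  x<0⇒0<-x : ∀ {x} → x ≤ 0# → ¬ 0# ≈ x → 0# < - x
  x<0⇒0<-x {x} x≤0 0≉x = ≤0⇒0≤- x≤0 , λ 0≈-x →
    0≉x (trans (sym -0#≈0#) (trans (-‿cong 0≈-x) (-‿involutive x)))

  0≤*⇒0≤ : ∀ {x y} → 0# < y → 0# ≤ x * y → 0# ≤ x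
  0≤*⇒0≤ {x} {y} 0<y 0≤xy with total 0# x | 0# ≟ x
  ... | inj₁ 0≤x | _       = 0≤x
  ... | inj₂ x≤0 | yes 0≈x = ≤-reflexive 0≈x
  ... | inj₂ x≤0 | no 0≉x  = contradiction
    (≤-respʳ-≈ (solve 2 (λ x y → x :* y := :- (:- x :* y)) refl x y) 0≤xy)
    (¬0<x∧0≤-x (0<*0< (x<0⇒0<-x x≤0 0≉x) 0<y))

  0<*⇒0< : ∀ {x y} → 0# < y → 0# < x * y → 0# < x
  0<*⇒0< {x} {y} 0<y 0<xy = 0≤*⇒0≤ 0<y (proj₁ 0<xy) , λ 0≈x →
    proj₂ 0<xy (trans (sym (zeroˡ y)) (*-congʳ 0≈x))

  0≤x*x : ∀ x → 0# ≤ x * x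
  0≤x*x x with total 0# x
  ... | inj₁ 0≤x = *-nonNegative 0≤x 0≤x
  ... | inj₂ x≤0 = ≤-respʳ-≈ (solve 1 (λ x → :- x :* :- x := x :* x) refl x)
    (*-nonNegative (≤0⇒0≤- x≤0) (≤0⇒0≤- x≤0))

  x*x≈0⇒x≈0 : ∀ {x} → x * x ≈ 0# → x ≈ 0#
  x*x≈0⇒x≈0 {x} xx≈0 with 0# ≟ x | total 0# x
  ... | yes 0≈x | _        = sym 0≈x
  ... | no 0≉x  | inj₁ 0≤x = contradiction (sym xx≈0) (proj₂ (0<*0< (0≤x , 0≉x) (0≤x , 0≉x)))
  ... | no 0≉x  | inj₂ x≤0 = contradiction
    (trans (sym xx≈0) (solve 1 (λ x → x :* x := :- x :* :- x) refl x))
    (proj₂ (0<*0< (x<0⇒0<-x x≤0 0≉x) (x<0⇒0<-x x≤0 0≉x)))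

  0<1 : 0# < 1#
  0<1 = ≤-respʳ-≈ (*-identityˡ 1#) (0≤x*x 1#) , 0≉1

  0≤fromℤ : ∀ n → 0# ≤ fromℤ (+ n)
  0≤fromℤ zero    = ≤-refl
  0≤fromℤ (suc n) = 0≤+0≤ (proj₁ 0<1) (0≤fromℤ n)

  -- √ is not assumed to respect _≈_, so both directions go through the squares.
  √-cancel-≤ : ∀ {x y} → 0# ≤ x → 0# ≤ y → √ x ≤ √ y → x ≤ y
  √-cancel-≤ {x} {y} 0≤x 0≤y √x≤√y = 0≤y-x⇒x≤y (≤-respʳ-≈ (begin
    (√ y - √ x) * (√ y + √ x)
      ≈⟨ solve 2 (λ a b → (b :- a) :* (b :+ a) := b :* b :- a :* a) refl (√ x) (√ y) ⟩
    √ y * √ y - √ x * √ x       ≈⟨ +-cong (√-square 0≤y) (-‿cong (√-square 0≤x)) ⟩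
    y - x                       ∎)
    (*-nonNegative (x≤y⇒0≤y-x √x≤√y) (0≤+0≤ (√-nonNegative 0≤y) (√-nonNegative 0≤x))))

  √-mono-≤ : ∀ {x y} → 0# ≤ x → 0# ≤ y → x ≤ y → √ x ≤ √ y
  √-mono-≤ {x} {y} 0≤x 0≤y x≤y with total (√ x) (√ y) | √ x ≟ √ y
  ... | inj₁ √x≤√y | _         = √x≤√y
  ... | inj₂ √y≤√x | yes √x≈√y = ≤-reflexive √x≈√y
  ... | inj₂ √y≤√x | no √x≉√y  = contradiction x≤y (<⇒≱ (0<y-x⇒x<y (<-respʳ-≈ (begin
    -- The factor √ x + √ y is split in this way so that its positivity follows from √ y < √ x and 0
    -- ≤ √ y, without knowing that √ y is positive.
    (√ x - √ y) * (√ x - √ y + (√ y + √ y))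
      ≈⟨ solve 2 (λ a b → (a :- b) :* (a :- b :+ (b :+ b)) := a :* a :- b :* b) refl (√ x) (√ y) ⟩
    √ x * √ x - √ y * √ y       ≈⟨ +-cong (√-square 0≤x) (-‿cong (√-square 0≤y)) ⟩
    x - y                       ∎)
    (0<*0< 0<√x-√y (0<+0≤ 0<√x-√y (0≤+0≤ (√-nonNegative 0≤y) (√-nonNegative 0≤y)))))))
    where
    0<√x-√y : 0# < √ x - √ y
    0<√x-√y = x<y⇒0<y-x (√y≤√x , λ √y≈√x → √x≉√y (sym √y≈√x))

-- Gram data and the algorithm

module GramForms {c ℓ₁ ℓ₂} (F : ArchimedeanEuclideanField c ℓ₁ ℓ₂) where
  open ArchimedeanEuclideanField F hiding (refl; sym; trans)
  open FieldProperties F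
  open Lattice F
  private module ≈ = Setoid setoid

  Gram-setoid : Setoid c ℓ₁
  Gram-setoid = ×-setoid setoid (×-setoid setoid setoid)

  open Setoid Gram-setoid using ()
    renaming (Carrier to Gram; _≈_ to _≋_; refl to ≋-refl; sym to ≋-sym; trans to ≋-trans)
  module ≋-Reasoning = SetoidReasoning Gram-setoid

  -- The third entry is twice the scalar product: a basis with p > 0 is then proper precisely when 0
  -- ≤ p + s and 0 < p - s, with neither division nor ½.
  gram : M₂ Carrier → Gram
  gram (b₁ , b₂) = b₁ · b₁ , b₂ · b₂ , b₂ · b₁ + b₂ · b₁

  σ : Gram → Gram
  σ (p , q , s) = q , p , s

  -- The Gram data of (b₁, b₂ + x b₁).
  τ : Carrier → Gram → Gram
  τ x (p , q , s) = p , q + x * s + x * x * p , s + x * p + x * p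

  -- The Gram data of (- b₁, b₂), or equally of (b₁, - b₂).
  conj : Gram → Gram
  conj (p , q , s) = p , q , - s

  actₗ : Letter → Gram → Gram
  actₗ S   = σ
  actₗ T   = τ (fromℤ 1ℤ)
  actₗ T⁻¹ = τ (fromℤ -1ℤ)

  act : Word → Gram → Gram
  act w g = foldr actₗ g w

  σ-cong : ∀ {g h} → g ≋ h → σ g ≋ σ h
  σ-cong (p , q , s) = q , p , s

  τ-cong : ∀ {x y g h} → x ≈ y → g ≋ h → τ x g ≋ τ y h
  τ-cong x (p , q , s) = p
    , +-cong (+-cong q (*-cong x s)) (*-cong (*-cong x x) p)
    , +-cong (+-cong s (*-cong x p)) (*-cong x p)

  τ-+ : ∀ x y g → τ x (τ y g) ≋ τ (x + y) g
  τ-+ x y (p , q , s) = ≈.refl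
    , solve 5 (λ x y p q s →
        q :+ y :* s :+ y :* y :* p :+ x :* (s :+ y :* p :+ y :* p) :+ x :* x :* p
        := q :+ (x :+ y) :* s :+ (x :+ y) :* (x :+ y) :* p) ≈.refl x y p q s
    , solve 4 (λ x y p s →
        s :+ y :* p :+ y :* p :+ x :* p :+ x :* p
        := s :+ (x :+ y) :* p :+ (x :+ y) :* p) ≈.refl x y p s

  τ-fromℤ-+ : ∀ i j g → τ (fromℤ i) (τ (fromℤ j) g) ≋ τ (fromℤ (i ℤ.+ j)) g
  τ-fromℤ-+ i j g = ≋-trans (τ-+ _ _ g) (τ-cong (≈.sym (fromℤ-+ i j)) ≋-refl)

  τ-0 : ∀ g → τ (fromℤ 0ℤ) g ≋ g
  τ-0 (p , q , s) = ≈.refl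
    , solve 3 (λ p q s → q :+ con 0ℤ :* s :+ con 0ℤ :* con 0ℤ :* p := q) ≈.refl p q s
    , solve 2 (λ p s → s :+ con 0ℤ :* p :+ con 0ℤ :* p := s) ≈.refl p s

  τ-inverse : ∀ x g → τ (- x) (τ x g) ≋ g
  τ-inverse x g = ≋-trans (τ-+ (- x) x g) (≋-trans (τ-cong (-‿inverseˡ x) ≋-refl) (τ-0 g))

  conj-τ : ∀ x g → τ (- x) (conj g) ≋ conj (τ x g)
  conj-τ x (p , q , s) = ≈.refl
    , solve 4 (λ x p q s → q :+ :- x :* :- s :+ :- x :* :- x :* p := q :+ x :* s :+ x :* x :* p)
        ≈.refl x p q s
    , solve 3 (λ x p s → :- s :+ :- x :* p :+ :- x :* p := :- (s :+ x :* p :+ x :* p)) ≈.refl x p s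

  act-cong : ∀ w {g h} → g ≋ h → act w g ≋ act w h
  act-cong []        g≋h = g≋h
  act-cong (S ∷ w)   g≋h = σ-cong (act-cong w g≋h)
  act-cong (T ∷ w)   g≋h = τ-cong ≈.refl (act-cong w g≋h)
  act-cong (T⁻¹ ∷ w) g≋h = τ-cong ≈.refl (act-cong w g≋h)

  act-T^ : ∀ x w g → act (T^ x ++ w) g ≋ τ (fromℤ x) (act w g)
  act-T^ (+ zero)      w g = ≋-sym (τ-0 (act w g))
  act-T^ (+ suc n)     w g = ≋-trans
    (τ-cong ≈.refl (act-T^ (+ n) w g)) (τ-fromℤ-+ 1ℤ (+ n) (act w g))
  act-T^ -[1+ zero ]   w g = ≋-refl
  act-T^ -[1+ suc n ]  w g = ≋-trans
    (τ-cong ≈.refl (act-T^ -[1+ n ] w g)) (τ-fromℤ-+ -1ℤ -[1+ n ] (act w g))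

  form : Gram → List ℤ → Gram
  form g []       = g
  form g (x ∷ xs) = σ (τ (fromℤ x) (form g xs))

  act-∏ : ∀ xs g → act (∏ xs) g ≋ form g xs
  act-∏ []       g = ≋-refl
  act-∏ (x ∷ xs) g = σ-cong (≋-trans (act-T^ x (∏ xs) g) (τ-cong ≈.refl (act-∏ xs g)))

  act-T^∏ : ∀ x xs g → act (T^ x ++ ∏ xs) g ≋ τ (fromℤ x) (form g xs)
  act-T^∏ x xs g = ≋-trans (act-T^ x (∏ xs) g) (τ-cong ≈.refl (act-∏ xs g))

  form-neg : ∀ xs g → form (conj g) (map ℤ.-_ xs) ≋ conj (form g xs)
  form-neg []       g = ≋-refl
  form-neg (x ∷ xs) g = σ-cong
    (≋-trans (τ-cong (fromℤ-neg x) (form-neg xs g)) (conj-τ (fromℤ x) (form g xs)))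

  -- The rules as polynomial identities between Gram data.

  Gramₚ : ℕ → Set
  Gramₚ n = Polynomial n × Polynomial n × Polynomial n

  σₚ : ∀ {n} → Gramₚ n → Gramₚ n
  σₚ (p , q , s) = q , p , s

  τₚ : ∀ {n} → Polynomial n → Gramₚ n → Gramₚ n
  τₚ x (p , q , s) = p , q :+ x :* s :+ x :* x :* p , s :+ x :* p :+ x :* p

  στστ : Carrier → Carrier → Gram → Gram
  στστ x y g = σ (τ x (σ (τ y g)))

  στστₚ : ∀ {n} → Polynomial n → Polynomial n → Gramₚ n → Gramₚ n
  στστₚ x y g = σₚ (τₚ x (σₚ (τₚ y g)))

  R3-identity : ∀ x g → στστ (fromℤ (+ 2)) x g ≋
    τ (fromℤ 1ℤ) (στστ (fromℤ -[1+ 1 ]) (x + fromℤ 1ℤ) g)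
  R3-identity x (p , q , s) =
      solve 4 (λ x p q s → proj₁ (lhs x p q s) := proj₁ (rhs x p q s)) ≈.refl x p q s
    , solve 4 (λ x p q s → proj₁ (proj₂ (lhs x p q s)) := proj₁ (proj₂ (rhs x p q s)))
        ≈.refl x p q s
    , solve 4 (λ x p q s → proj₂ (proj₂ (lhs x p q s)) := proj₂ (proj₂ (rhs x p q s)))
        ≈.refl x p q s
    where
    lhs rhs : ∀ {n} → (x p q s : Polynomial n) → Gramₚ n
    lhs x p q s = στστₚ (con (+ 2)) x (p , q , s)
    rhs x p q s = τₚ (con 1ℤ) (στστₚ (con -[1+ 1 ]) (x :+ con 1ℤ) (p , q , s))

  R4-identity : ∀ x g → στστ (fromℤ -[1+ 1 ]) x g ≋
    τ (fromℤ -1ℤ) (στστ (fromℤ (+ 2)) (x + fromℤ -1ℤ) g)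
  R4-identity x (p , q , s) =
      solve 4 (λ x p q s → proj₁ (lhs x p q s) := proj₁ (rhs x p q s)) ≈.refl x p q s
    , solve 4 (λ x p q s → proj₁ (proj₂ (lhs x p q s)) := proj₁ (proj₂ (rhs x p q s)))
        ≈.refl x p q s
    , solve 4 (λ x p q s → proj₂ (proj₂ (lhs x p q s)) := proj₂ (proj₂ (rhs x p q s)))
        ≈.refl x p q s
    where
    lhs rhs : ∀ {n} → (x p q s : Polynomial n) → Gramₚ n
    lhs x p q s = στστₚ (con -[1+ 1 ]) x (p , q , s)
    rhs x p q s = τₚ (con -1ℤ) (στστₚ (con (+ 2)) (x :+ con -1ℤ) (p , q , s))

  R5-identity : ∀ x g → στστ (fromℤ 1ℤ) x g ≋ τ (fromℤ 1ℤ) (σ (τ (- x + fromℤ -1ℤ) (conj g)))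
  R5-identity x (p , q , s) =
      solve 4 (λ x p q s → proj₁ (lhs x p q s) := proj₁ (rhs x p q s)) ≈.refl x p q s
    , solve 4 (λ x p q s → proj₁ (proj₂ (lhs x p q s)) := proj₁ (proj₂ (rhs x p q s)))
        ≈.refl x p q s
    , solve 4 (λ x p q s → proj₂ (proj₂ (lhs x p q s)) := proj₂ (proj₂ (rhs x p q s)))
        ≈.refl x p q s
    where
    lhs rhs : ∀ {n} → (x p q s : Polynomial n) → Gramₚ n
    lhs x p q s = στστₚ (con 1ℤ) x (p , q , s)
    rhs x p q s = τₚ (con 1ℤ) (σₚ (τₚ (:- x :+ con -1ℤ) (p , q , :- s)))

  R6-identity : ∀ x g → στστ (fromℤ -1ℤ) x g ≋ τ (fromℤ -1ℤ) (σ (τ (- x + fromℤ 1ℤ) (conj g)))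
  R6-identity x (p , q , s) =
      solve 4 (λ x p q s → proj₁ (lhs x p q s) := proj₁ (rhs x p q s)) ≈.refl x p q s
    , solve 4 (λ x p q s → proj₁ (proj₂ (lhs x p q s)) := proj₁ (proj₂ (rhs x p q s)))
        ≈.refl x p q s
    , solve 4 (λ x p q s → proj₂ (proj₂ (lhs x p q s)) := proj₂ (proj₂ (rhs x p q s)))
        ≈.refl x p q s
    where
    lhs rhs : ∀ {n} → (x p q s : Polynomial n) → Gramₚ n
    lhs x p q s = στστₚ (con -1ℤ) x (p , q , s)
    rhs x p q s = τₚ (con -1ℤ) (σₚ (τₚ (:- x :+ con 1ℤ) (p , q , :- s)))

  -- Growth of norms along a Gaussian word.

  record Base (g : Gram) : Set (ℓ₁ ⊔ ℓ₂) where
    constructor base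
    p = proj₁ g
    q = proj₁ (proj₂ g)
    s = proj₂ (proj₂ g)
    field
      0<p   : 0# < p
      0<p+s : 0# < p + s
      0<p-s : 0# < p - s
      0<q-p : 0# < q - p

  -- Here the strictness of -½ < m matters: a reduced basis with m = -½ would be sent to one with m
  -- = ½, which is not proper.
  conj-base : ∀ {g} → Base g → Base (conj g)
  conj-base (base 0<p 0<p+s 0<p-s 0<q-p) = base 0<p 0<p-s
    (<-respʳ-≈ (+-congˡ (≈.sym (-‿involutive _))) 0<p+s) 0<q-p

  infix 4 _⊑_

  -- The Gram data may change along a step, because `R5` and `R6` trade `g` for `conj g`. Keeping
  -- only the existence of suitable data makes the relation compose along a whole reduction.
  _⊑_ : Rel Word (c ⊔ ℓ₁ ⊔ ℓ₂)
  w ⊑ w′ = ∀ g → Base g → ∃ λ g′ → Base g′ × act w g ≋ act w′ g′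

  ⊑-++ : ∀ u {w w′} → w ⊑ w′ → u ++ w ⊑ u ++ w′
  ⊑-++ u {w} {w′} w⊑w′ g bg with w⊑w′ g bg
  ... | g′ , bg′ , eq = g′ , bg′ , (begin
    act (u ++ w) g     ≡⟨ foldr-++ actₗ g u w ⟩
    act u (act w g)    ≈⟨ act-cong u eq ⟩
    act u (act w′ g′)  ≡⟨ foldr-++ actₗ g′ u w′ ⟨
    act (u ++ w′) g′   ∎)
    where open ≋-Reasoning

  act-T^∏∏ : ∀ e x y z ys g → fromℤ y ≈ z → act (T^ e ++ ∏ (x ∷ y ∷ ys)) g ≋
    τ (fromℤ e) (σ (τ (fromℤ x) (σ (τ z (form g ys)))))
  act-T^∏∏ e x y z ys g y≈z = ≋-trans (act-T^∏ e (x ∷ y ∷ ys) g)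
    (τ-cong ≈.refl (σ-cong (τ-cong ≈.refl (σ-cong (τ-cong y≈z ≋-refl)))))

  act-T^∏-neg : ∀ e x z ys g → fromℤ x ≈ z → act (T^ e ++ ∏ (x ∷ map ℤ.-_ ys)) (conj g) ≋
    τ (fromℤ e) (σ (τ z (conj (form g ys))))
  act-T^∏-neg e x z ys g x≈z = ≋-trans (act-T^∏ e (x ∷ map ℤ.-_ ys) (conj g))
    (τ-cong ≈.refl (σ-cong (τ-cong x≈z (form-neg ys g))))

  ⟶₀⇒⊑ : ∀ {w w′} → w ⟶₀ w′ → w ⊑ w′
  ⟶₀⇒⊑ (R1 u v)       = ⊑-++ u λ g bg → g , bg , ≋-refl
  ⟶₀⇒⊑ (R2 u x y v _) = ⊑-++ u λ g bg → g , bg , (begin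
    act (T^ x ++ T^ y ++ v) g                  ≈⟨ act-T^ x (T^ y ++ v) g ⟩
    τ (fromℤ x) (act (T^ y ++ v) g)            ≈⟨ τ-cong ≈.refl (act-T^ y v g) ⟩
    τ (fromℤ x) (τ (fromℤ y) (act v g))        ≈⟨ τ-fromℤ-+ x y (act v g) ⟩
    τ (fromℤ (x ℤ.+ y)) (act v g)              ≈⟨ act-T^ (x ℤ.+ y) v g ⟨
    act (T^ (x ℤ.+ y) ++ v) g                  ∎)
    where open ≋-Reasoning

  ⟶⇒⊑ : ∀ {w w′} → w ⟶ w′ → w ⊑ w′
  ⟶⇒⊑ (trivial step)   = ⟶₀⇒⊑ step
  ⟶⇒⊑ (R3 u x ys _ _) = ⊑-++ u λ g bg → g , bg ,
    ≋-trans (act-∏ (+ 2 ∷ x ∷ ys) g)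
      (≋-trans (R3-identity (fromℤ x) (form g ys))
        (≋-sym (act-T^∏∏ 1ℤ -[1+ 1 ] (x ℤ.+ 1ℤ) _ ys g (fromℤ-+ x 1ℤ))))
  ⟶⇒⊑ (R4 u x ys _ _) = ⊑-++ u λ g bg → g , bg ,
    ≋-trans (act-∏ (-[1+ 1 ] ∷ x ∷ ys) g)
      (≋-trans (R4-identity (fromℤ x) (form g ys))
        (≋-sym (act-T^∏∏ -1ℤ (+ 2) (x ℤ.- 1ℤ) _ ys g (fromℤ-+ x -1ℤ))))
  ⟶⇒⊑ (R5 u x ys _)   = ⊑-++ u λ g bg → conj g , conj-base bg ,
    ≋-trans (act-∏ (1ℤ ∷ x ∷ ys) g)
      (≋-trans (R5-identity (fromℤ x) (form g ys))
        (≋-sym (act-T^∏-neg 1ℤ (ℤ.- x ℤ.- 1ℤ) _ ys g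
          (≈.trans (fromℤ-+ (ℤ.- x) -1ℤ) (+-congʳ (fromℤ-neg x))))))
  ⟶⇒⊑ (R6 u x ys _)   = ⊑-++ u λ g bg → conj g , conj-base bg ,
    ≋-trans (act-∏ (-1ℤ ∷ x ∷ ys) g)
      (≋-trans (R6-identity (fromℤ x) (form g ys))
        (≋-sym (act-T^∏-neg -1ℤ (ℤ.- x ℤ.+ 1ℤ) _ ys g
          (≈.trans (fromℤ-+ (ℤ.- x) 1ℤ) (+-congʳ (fromℤ-neg x))))))

  ⟶*⇒⊑ : ∀ {w w′} → Star _⟶_ w w′ → w ⊑ w′
  ⟶*⇒⊑ ε              g bg = g , bg , ≋-refl
  ⟶*⇒⊑ (step ◅ steps) g bg with ⟶⇒⊑ step g bg
  ... | g′ , bg′ , eq with ⟶*⇒⊑ steps g′ bg′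
  ...   | g″ , bg″ , eq′ = g″ , bg″ , ≋-trans eq eq′

  -- For (p′ , q′ , s′) = σ (τ x g), the gaps at x and x ± 1 are p′ - q′ and p′ ± s′.
  gap : Carrier → Gram → Carrier
  gap n (p , q , s) = n * n * p + n * s + (q - p)

  gap-neg : ∀ n g → gap n g ≈ gap (- n) (conj g)
  gap-neg n (p , q , s) = solve 4 (λ n p q s →
    n :* n :* p :+ n :* s :+ (q :- p) := :- n :* :- n :* p :+ :- n :* :- s :+ (q :- p))
    ≈.refl n p q s

  gap-cong : ∀ {n n′} g → n ≈ n′ → gap n g ≈ gap n′ g
  gap-cong g n≈n′ = +-congʳ (+-cong (*-congʳ (*-cong n≈n′ n≈n′)) (*-congʳ n≈n′))

  -- The gap at n is |b₂ + n b₁|² - |b₁|². At n + 1 it equals (q - p) + (n + 1)(p + s) + (n² + n) p,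
  -- a sum of terms that are non-negative, the first being positive.
  0<gap-base-+ : ∀ {g} → Base g → ∀ n → 0# < gap (fromℤ (+ n)) g
  0<gap-base-+ {p , q , s} (base _ _ _ 0<q-p) zero = <-respʳ-≈
    (solve 3 (λ p q s → q :- p := con 0ℤ :* con 0ℤ :* p :+ con 0ℤ :* s :+ (q :- p)) ≈.refl p q s)
    0<q-p
  0<gap-base-+ {g@(p , q , s)} (base 0<p 0<p+s _ 0<q-p) (suc n) = <-respʳ-≈
    (≈.trans (solve 4 (λ n p q s →
        q :- p :+ ((p :+ s) :+ (n :* (p :+ s) :+ (n :* n :+ n) :* p))
        := (con 1ℤ :+ n) :* (con 1ℤ :+ n) :* p :+ (con 1ℤ :+ n) :* s :+ (q :- p)) ≈.refl N p q s)
      (gap-cong g (≈.sym (fromℤ-+ 1ℤ (+ n)))))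
    (0<+0≤ 0<q-p (0≤+0≤ (proj₁ 0<p+s) (0≤+0≤ (*-nonNegative 0≤N (proj₁ 0<p+s))
      (*-nonNegative (0≤+0≤ (*-nonNegative 0≤N 0≤N) 0≤N) (proj₁ 0<p)))))
    where
    N : Carrier
    N = fromℤ (+ n)
    0≤N : 0# ≤ N
    0≤N = 0≤fromℤ n

  0<gap-base : ∀ {g} → Base g → ∀ n → 0# < gap (fromℤ n) g
  0<gap-base     bg (+ n)    = 0<gap-base-+ bg n
  0<gap-base {g} bg -[1+ n ] = <-respʳ-≈
    (≈.trans (gap-cong (conj g) (≈.sym (-‿involutive _))) (≈.sym (gap-neg (fromℤ -[1+ n ]) g)))
    (0<gap-base-+ (conj-base bg) (suc n))

  -- The invariant after a letter S T^x: the basis is strictly proper and its first vector is the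
  -- longer one. The two conditional fields record what the sign of `x` says about |b₁ + b₂| or |b₁
  -- - b₂|; they are exactly what a following exponent 2 or -2 consumes.
  record Grown (x : ℤ) (g : Gram) : Set (ℓ₁ ⊔ ℓ₂) where
    constructor grown
    p = proj₁ g
    q = proj₁ (proj₂ g)
    s = proj₂ (proj₂ g)
    field
      0<q   : 0# < q
      0<p+s : 0# < p + s
      0<p-s : 0# < p - s
      0<p-q : 0# < p - q
      0<q+s : 0ℤ ℤ.≤ x → 0# < q + s
      0<q-s : x ℤ.≤ 0ℤ → 0# < q - s

  conj-grown : ∀ {x g} → Grown x g → Grown (ℤ.- x) (conj g)
  conj-grown (grown 0<q 0<p+s 0<p-s 0<p-q 0<q+s 0<q-s) = grown 0<q 0<p-s
    (<-respʳ-≈ (+-congˡ (≈.sym (-‿involutive _))) 0<p+s) 0<p-q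
    (λ 0≤-x → 0<q-s (subst (ℤ._≤ 0ℤ) (ℤ.neg-involutive _) (ℤ.neg-mono-≤ 0≤-x)))
    (λ -x≤0 → <-respʳ-≈ (+-congˡ (≈.sym (-‿involutive _)))
      (0<q+s (subst (0ℤ ℤ.≤_) (ℤ.neg-involutive _) (ℤ.neg-mono-≤ -x≤0))))

  grown⇒0<p : ∀ {x g} → Grown x g → 0# < proj₁ g
  grown⇒0<p {g = p , q , s} (grown 0<q _ _ 0<p-q _ _) = <-respʳ-≈
    (solve 2 (λ p q → q :+ (p :- q) := p) ≈.refl p q) (0<+0< 0<q 0<p-q)

  grow : ∀ x {g} → 0# < proj₁ g → 0# < proj₁ g + proj₂ (proj₂ g) → 0# < proj₁ g - proj₂ (proj₂ g) →
    0# < gap (fromℤ x - fromℤ 1ℤ) g → 0# < gap (fromℤ x) g → 0# < gap (fromℤ x + fromℤ 1ℤ) g →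
    Grown x (σ (τ (fromℤ x) g))
  grow x {p , q , s} 0<p 0<p+s 0<p-s 0<gap₋ 0<gap 0<gap₊ = grown 0<p
    (<-respʳ-≈ (solve 4 (λ x p q s →
      (x :+ con 1ℤ) :* (x :+ con 1ℤ) :* p :+ (x :+ con 1ℤ) :* s :+ (q :- p)
      := q :+ x :* s :+ x :* x :* p :+ (s :+ x :* p :+ x :* p)) ≈.refl X p q s) 0<gap₊)
    (<-respʳ-≈ (solve 4 (λ x p q s →
      (x :- con 1ℤ) :* (x :- con 1ℤ) :* p :+ (x :- con 1ℤ) :* s :+ (q :- p)
      := q :+ x :* s :+ x :* x :* p :- (s :+ x :* p :+ x :* p)) ≈.refl X p q s) 0<gap₋)
    (<-respʳ-≈ (solve 4 (λ x p q s →
      x :* x :* p :+ x :* s :+ (q :- p) := q :+ x :* s :+ x :* x :* p :- p) ≈.refl X p q s) 0<gap)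
    (λ 0≤x → <-respʳ-≈ (solve 3 (λ x p s →
      p :+ s :+ (x :* p :+ x :* p) := p :+ (s :+ x :* p :+ x :* p)) ≈.refl X p s)
      (0<+0≤ 0<p+s (0≤+0≤ (0≤Xp 0≤x) (0≤Xp 0≤x))))
    (λ x≤0 → <-respʳ-≈ (solve 3 (λ x p s →
      p :- s :+ (:- x :* p :+ :- x :* p) := p :- (s :+ x :* p :+ x :* p)) ≈.refl X p s)
      (0<+0≤ 0<p-s (0≤+0≤ (0≤-Xp x≤0) (0≤-Xp x≤0))))
    where
    X : Carrier
    X = fromℤ x
    0≤Xp : 0ℤ ℤ.≤ x → 0# ≤ X * p
    0≤Xp (ℤ.+≤+ {n = n} _) = *-nonNegative (0≤fromℤ n) (proj₁ 0<p)
    0≤-X : ∀ y → y ℤ.≤ 0ℤ → 0# ≤ - fromℤ y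
    0≤-X (+ zero)  _ = ≤-reflexive (≈.sym -0#≈0#)
    0≤-X (+ suc n) (ℤ.+≤+ ())
    0≤-X -[1+ n ]  _ = ≤-respʳ-≈ (≈.sym (-‿involutive _)) (0≤fromℤ (suc n))
    0≤-Xp : x ℤ.≤ 0ℤ → 0# ≤ - X * p
    0≤-Xp x≤0 = *-nonNegative (0≤-X x x≤0) (proj₁ 0<p)

  -- For k = n + 2 the gap is q + k (p + s) + (k² - k - 1) p. The last coefficient is positive from
  -- k = 2 on, but equals -1 at k = 1, where the gap reduces to q + s and needs information on the
  -- sign.
  0<gap-grown : ∀ {y g} → Grown y g → ∀ n → 0# < gap (fromℤ (+ (2 ℕ.+ n))) g
  0<gap-grown {g = g@(p , q , s)} gr@(grown 0<q 0<p+s _ _ _ _) n = <-respʳ-≈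
    (≈.trans (solve 4 (λ n p q s →
        q :+ ((p :+ s) :+ (p :+ s) :+ n :* (p :+ s) :+ (p :+ (n :* n :+ n :+ n :+ n) :* p))
        := (con (+ 2) :+ n) :* (con (+ 2) :+ n) :* p :+ (con (+ 2) :+ n) :* s :+ (q :- p))
        ≈.refl N p q s)
      (gap-cong g (≈.sym (fromℤ-+ (+ 2) (+ n)))))
    (0<+0≤ 0<q (0≤+0≤ (0≤+0≤ (0≤+0≤ (proj₁ 0<p+s) (proj₁ 0<p+s)) (*-nonNegative 0≤N (proj₁ 0<p+s)))
      (0≤+0≤ (proj₁ (grown⇒0<p gr)) (*-nonNegative
        (0≤+0≤ (0≤+0≤ (0≤+0≤ (*-nonNegative 0≤N 0≤N) 0≤N) 0≤N) 0≤N) (proj₁ (grown⇒0<p gr))))))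
    where
    N : Carrier
    N = fromℤ (+ n)
    0≤N : 0# ≤ N
    0≤N = 0≤fromℤ n

  grow-pos : ∀ {y g} n → Grown y g → 0# < gap (fromℤ (+ suc n)) g →
    Grown (+ (2 ℕ.+ n)) (σ (τ (fromℤ (+ (2 ℕ.+ n))) g))
  grow-pos {g = g} n gr 0<gap = grow (+ (2 ℕ.+ n)) (grown⇒0<p gr) (Grown.0<p+s gr) (Grown.0<p-s gr)
    (<-respʳ-≈ (gap-cong g (fromℤ-+ (+ (2 ℕ.+ n)) -1ℤ)) 0<gap)
    (0<gap-grown gr n)
    (<-respʳ-≈ (gap-cong g (≈.trans (fromℤ-+ 1ℤ (+ (2 ℕ.+ n))) (+-comm _ _)))
      (0<gap-grown gr (suc n)))

  grown-resp-≋ : ∀ {x g h} → g ≋ h → Grown x g → Grown x h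
  grown-resp-≋ (p , q , s) (grown 0<q 0<p+s 0<p-s 0<p-q 0<q+s 0<q-s) = grown
    (<-respʳ-≈ q 0<q)
    (<-respʳ-≈ (+-cong p s) 0<p+s) (<-respʳ-≈ (+-cong p (-‿cong s)) 0<p-s)
    (<-respʳ-≈ (+-cong p (-‿cong q)) 0<p-q)
    (λ 0≤x → <-respʳ-≈ (+-cong q s) (0<q+s 0≤x))
    (λ x≤0 → <-respʳ-≈ (+-cong q (-‿cong s)) (0<q-s x≤0))

  -- Reflection of `grow-pos`: `conj` negates the exponent, and applying it twice gives back `g` up
  -- to `_≋_`.
  grow-neg : ∀ {y g} n → Grown y g → 0# < gap (fromℤ (+ suc n)) (conj g) →
    Grown -[1+ suc n ] (σ (τ (fromℤ -[1+ suc n ]) g))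
  grow-neg {g = g} n gr 0<gap = grown-resp-≋
    (σ-cong (≋-trans (≋-sym (conj-τ _ (conj g)))
      (τ-cong ≈.refl (≈.refl , ≈.refl , -‿involutive _))))
    (conj-grown (grow-pos n (conj-grown gr) 0<gap))

  gap-1 : ∀ p q s → q + s ≈ gap (fromℤ 1ℤ) (p , q , s)
  gap-1 = solve 3 (λ p q s → q :+ s := con 1ℤ :* con 1ℤ :* p :+ con 1ℤ :* s :+ (q :- p)) ≈.refl

  -- The innermost exponent acts on a `Base`, whose gaps are positive at every integer, so it may be
  -- arbitrary. Every other exponent acts on `Grown` data, where the gaps at x and x ± 1 must be
  -- positive; this is what `Admissible` guarantees.
  grown-form : ∀ {g} x xs → Base g → Gaussian (x ∷ xs) → Grown x (form g (x ∷ xs))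
  grown-form {g} x [] bg@(base 0<p 0<p+s 0<p-s _) [-] = grow x 0<p 0<p+s 0<p-s
    (<-respʳ-≈ (gap-cong g (fromℤ-+ x -1ℤ)) (0<gap-base bg (x ℤ.- 1ℤ)))
    (0<gap-base bg x)
    (<-respʳ-≈ (gap-cong g (fromℤ-+ x 1ℤ)) (0<gap-base bg (x ℤ.+ 1ℤ)))
  grown-form x (y ∷ ys) bg (xy ∷ gauss) = extend xy (grown-form y ys bg gauss)
    where
    extend : ∀ {x y g} → Admissible x y → Grown y g → Grown x (σ (τ (fromℤ x) g))
    extend (≥3 n)    gr = grow-pos (suc n) gr (0<gap-grown gr n)
    extend (≤-3 n)   gr = grow-neg (suc n) gr (0<gap-grown (conj-grown gr) n)
    -- The three gaps needed are at 1, 2 and 3; only the one at 1 depends on the sign of `y`.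
    extend (=2 0≤y)  gr = grow-pos 0 gr (<-respʳ-≈ (gap-1 _ _ _) (Grown.0<q+s gr 0≤y))
    extend (=-2 y≤0) gr = grow-neg 0 gr (<-respʳ-≈ (gap-1 _ _ _) (Grown.0<q-s gr y≤0))

  -- Norms, properness and translations in terms of Gram data.

  0≤v·v : ∀ v → 0# ≤ v · v
  0≤v·v (x , y) = 0≤+0≤ (0≤x*x x) (0≤x*x y)

  ∣∣-mono-≤ : ∀ {u v} → u · u ≤ v · v → ∣ u ∣ ≤ ∣ v ∣
  ∣∣-mono-≤ {u} {v} = √-mono-≤ (0≤v·v u) (0≤v·v v)

  ∣∣-cancel-≤ : ∀ {u v} → ∣ u ∣ ≤ ∣ v ∣ → u · u ≤ v · v
  ∣∣-cancel-≤ {u} {v} = √-cancel-≤ (0≤v·v u) (0≤v·v v)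

  ∣∣-mono-< : ∀ {u v} → u · u < v · v → ∣ u ∣ < ∣ v ∣
  ∣∣-mono-< {u} {v} u<v = ≰⇒> λ v≤u → <⇒≱ u<v (∣∣-cancel-≤ {v} {u} v≤u)

  ∣∣-cancel-< : ∀ {u v} → ∣ u ∣ < ∣ v ∣ → u · u < v · v
  ∣∣-cancel-< {u} {v} u<v = ≰⇒> λ v≤u → <⇒≱ u<v (∣∣-mono-≤ {v} {u} v≤u)

  ½+½≈1 : ½ + ½ ≈ 1#
  ½+½≈1 = begin
    ½ + ½               ≈⟨ +-cong (*-identityˡ ½) (*-identityˡ ½) ⟨
    1# * ½ + 1# * ½     ≈⟨ distribʳ ½ 1# 1# ⟨
    (1# + 1#) * ½       ≈⟨ ⁻¹-inverseʳ (λ 2≈0 → proj₂ (0<+0< 0<1 0<1) (≈.sym 2≈0)) ⟩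
    1#                  ∎
    where open SetoidReasoning setoid

  module _ {b₁ b₂ : Row Carrier} (0<p : 0# < b₁ · b₁) where
    private
      p s : Carrier
      p = b₁ · b₁
      s = b₂ · b₁ + b₂ · b₁

      0<p+p : 0# < p + p
      0<p+p = 0<+0< 0<p 0<p

      m*2p≈s : m (b₁ , b₂) * (p + p) ≈ s
      m*2p≈s = begin
        (b₂ · b₁) * p ⁻¹ * (p + p)
          ≈⟨ solve 3 (λ r i p → r :* i :* (p :+ p) := r :* (p :* i) :+ r :* (p :* i))
               ≈.refl (b₂ · b₁) (p ⁻¹) p ⟩
        (b₂ · b₁) * (p * p ⁻¹) + (b₂ · b₁) * (p * p ⁻¹)
          ≈⟨ +-cong r*1≈r r*1≈r ⟩
        s ∎
        where
        open SetoidReasoning setoid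
        r*1≈r : (b₂ · b₁) * (p * p ⁻¹) ≈ b₂ · b₁
        r*1≈r = ≈.trans (*-congˡ (⁻¹-inverseʳ (λ p≈0 → proj₂ 0<p (≈.sym p≈0)))) (*-identityʳ _)

      ½*2p≈p : ½ * (p + p) ≈ p
      ½*2p≈p = begin
        ½ * (p + p)  ≈⟨ solve 2 (λ h p → h :* (p :+ p) := (h :+ h) :* p) ≈.refl ½ p ⟩
        (½ + ½) * p  ≈⟨ *-congʳ ½+½≈1 ⟩
        1# * p       ≈⟨ *-identityˡ p ⟩
        p            ∎
        where open SetoidReasoning setoid

      [m--½]*2p≈p+s : (m (b₁ , b₂) - - ½) * (p + p) ≈ p + s
      [m--½]*2p≈p+s = ≈.trans
        (solve 3 (λ m h t → (m :- :- h) :* t := h :* t :+ m :* t) ≈.refl (m (b₁ , b₂)) ½ (p + p))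
        (+-cong ½*2p≈p m*2p≈s)

      [½-m]*2p≈p-s : (½ - m (b₁ , b₂)) * (p + p) ≈ p - s
      [½-m]*2p≈p-s = ≈.trans
        (solve 3 (λ m h t → (h :- m) :* t := h :* t :- m :* t) ≈.refl (m (b₁ , b₂)) ½ (p + p))
        (+-cong ½*2p≈p (-‿cong m*2p≈s))

    proper⇒0≤p+s : - ½ ≤ m (b₁ , b₂) → 0# ≤ p + s
    proper⇒0≤p+s -½≤m = ≤-respʳ-≈ [m--½]*2p≈p+s (*-nonNegative (x≤y⇒0≤y-x -½≤m) (proj₁ 0<p+p))

    proper⇒0<p+s : - ½ < m (b₁ , b₂) → 0# < p + s
    proper⇒0<p+s -½<m = <-respʳ-≈ [m--½]*2p≈p+s (0<*0< (x<y⇒0<y-x -½<m) 0<p+p)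

    proper⇒0<p-s : m (b₁ , b₂) < ½ → 0# < p - s
    proper⇒0<p-s m<½ = <-respʳ-≈ [½-m]*2p≈p-s (0<*0< (x<y⇒0<y-x m<½) 0<p+p)

    0≤p+s∧0<p-s⇒proper : 0# ≤ p + s → 0# < p - s → Proper (b₁ , b₂)
    0≤p+s∧0<p-s⇒proper 0≤p+s 0<p-s =
        0≤y-x⇒x≤y (0≤*⇒0≤ 0<p+p (≤-respʳ-≈ (≈.sym [m--½]*2p≈p+s) 0≤p+s))
      , 0<y-x⇒x<y (0<*⇒0< 0<p+p (<-respʳ-≈ (≈.sym [½-m]*2p≈p-s) 0<p-s))

  gram-⊖ : ∀ x b₁ b₂ → gram (b₁ , b₂ ⊖ x • b₁) ≋ τ (- x) (gram (b₁ , b₂))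
  gram-⊖ x (a , b) (c , d) = ≈.refl
    , solve 5 (λ x a b c d →
        (c :- x :* a) :* (c :- x :* a) :+ (d :- x :* b) :* (d :- x :* b)
        := c :* c :+ d :* d :+ :- x :* (c :* a :+ d :* b :+ (c :* a :+ d :* b))
           :+ :- x :* :- x :* (a :* a :+ b :* b))
        ≈.refl x a b c d
    , solve 5 (λ x a b c d →
        (c :- x :* a) :* a :+ (d :- x :* b) :* b :+ ((c :- x :* a) :* a :+ (d :- x :* b) :* b)
        := c :* a :+ d :* b :+ (c :* a :+ d :* b)
           :+ :- x :* (a :* a :+ b :* b) :+ :- x :* (a :* a :+ b :* b))
        ≈.refl x a b c d

  gram-swap : ∀ b₁ b₂ → gram (b₂ , b₁) ≋ σ (gram (b₁ , b₂))
  gram-swap (a , b) (c , d) = ≈.refl , ≈.refl , +-cong comm comm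
    where
    comm : a * c + b * d ≈ c * a + d * b
    comm = +-cong (*-comm a c) (*-comm b d)

  record StrictlyProper (g : Gram) : Set (ℓ₁ ⊔ ℓ₂) where
    constructor strictlyProper
    p = proj₁ g
    s = proj₂ (proj₂ g)
    field
      0<p   : 0# < p
      0<p+s : 0# < p + s
      0<p-s : 0# < p - s

  strictlyProper-resp-≋ : ∀ {g h} → g ≋ h → StrictlyProper g → StrictlyProper h
  strictlyProper-resp-≋ (p , _ , s) (strictlyProper 0<p 0<p+s 0<p-s) = strictlyProper
    (<-respʳ-≈ p 0<p) (<-respʳ-≈ (+-cong p s) 0<p+s) (<-respʳ-≈ (+-cong p (-‿cong s)) 0<p-s)

  strictlyProper-form : ∀ {g} xs → Base g → Gaussian xs → StrictlyProper (form g xs)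
  strictlyProper-form []       (base 0<p 0<p+s 0<p-s _) _ = strictlyProper 0<p 0<p+s 0<p-s
  strictlyProper-form (x ∷ xs) bg gauss with grown-form x xs bg gauss
  ... | gr = strictlyProper (grown⇒0<p gr) (Grown.0<p+s gr) (Grown.0<p-s gr)

  -- A shift by d adds 2 d p to s. For d ≥ 1 this makes p - s negative, for d ≤ -1 it makes p + s
  -- negative, since originally |s| < p. The shifted data are assumed only as proper as the
  -- algorithm requires, hence the one weak inequality.
  shift-unique : ∀ {g} → StrictlyProper g → ∀ d →
    (let p , q , s = τ (fromℤ d) g) → 0# ≤ p + s → 0# < p - s → d ≡ 0ℤ
  shift-unique sp (+ zero) _ _ = ≡.refl
  shift-unique {p , q , s} (strictlyProper 0<p 0<p+s _) (+ suc n) _ 0<p-s′ = contradiction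
    (≤-respʳ-≈ (≈.trans
      (solve 3 (λ n p s → p :+ s :+ (n :* p :+ n :* p)
        := :- (p :- (s :+ (con 1ℤ :+ n) :* p :+ (con 1ℤ :+ n) :* p))) ≈.refl (fromℤ (+ n)) p s)
      (-‿cong (+-congˡ (-‿cong (+-cong (+-congˡ (*-congʳ 1+N)) (*-congʳ 1+N))))))
      (proj₁ (0<+0≤ 0<p+s (0≤+0≤ 0≤Np 0≤Np))))
    (¬0<x∧0≤-x 0<p-s′)
    where
    1+N : fromℤ 1ℤ + fromℤ (+ n) ≈ fromℤ (+ suc n)
    1+N = ≈.sym (fromℤ-+ 1ℤ (+ n))
    0≤Np : 0# ≤ fromℤ (+ n) * p
    0≤Np = *-nonNegative (0≤fromℤ n) (proj₁ 0<p)
  shift-unique {p , q , s} (strictlyProper 0<p _ 0<p-s) -[1+ n ] 0≤p+s′ _ = contradiction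
    (≤-respʳ-≈ (≈.trans
      (+-congˡ (+-cong (+-congˡ (*-congʳ (-‿cong 1+N))) (*-congʳ (-‿cong 1+N))))
      (solve 3 (λ n p s → p :+ (s :+ :- (con 1ℤ :+ n) :* p :+ :- (con 1ℤ :+ n) :* p)
        := :- (p :- s :+ (n :* p :+ n :* p))) ≈.refl (fromℤ (+ n)) p s))
      0≤p+s′)
    (¬0<x∧0≤-x (0<+0≤ 0<p-s (0≤+0≤ 0≤Np 0≤Np)))
    where
    1+N : fromℤ (+ suc n) ≈ fromℤ 1ℤ + fromℤ (+ n)
    1+N = fromℤ-+ 1ℤ (+ n)
    0≤Np : 0# ≤ fromℤ (+ n) * p
    0≤Np = *-nonNegative (0≤fromℤ n) (proj₁ 0<p)

  gram-shift : ∀ x y b₁ b₂ →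
    τ (fromℤ (x ℤ.- y)) (gram (b₁ , b₂ ⊖ fromℤ x • b₁)) ≋ gram (b₁ , b₂ ⊖ fromℤ y • b₁)
  gram-shift x y b₁ b₂ = begin
    τ (fromℤ (x ℤ.- y)) (gram (b₁ , b₂ ⊖ fromℤ x • b₁))  ≈⟨ τ-cong x-y (gram-⊖ (fromℤ x) b₁ b₂) ⟩
    τ (fromℤ x - fromℤ y) (τ (- fromℤ x) G)              ≈⟨ τ-+ _ _ G ⟩
    τ (fromℤ x - fromℤ y - fromℤ x) G
      ≈⟨ τ-cong (solve 2 (λ x y → x :- y :- x := :- y) ≈.refl (fromℤ x) (fromℤ y)) ≋-refl ⟩
    τ (- fromℤ y) G                                      ≈⟨ gram-⊖ (fromℤ y) b₁ b₂ ⟨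
    gram (b₁ , b₂ ⊖ fromℤ y • b₁)                        ∎
    where
    open ≋-Reasoning
    G : Gram
    G = gram (b₁ , b₂)
    x-y : fromℤ (x ℤ.- y) ≈ fromℤ x - fromℤ y
    x-y = ≈.trans (fromℤ-+ x (ℤ.- y)) (+-congˡ (fromℤ-neg y))

  translation-unique : ∀ x y {b₁ b₂} → StrictlyProper (gram (b₁ , b₂ ⊖ fromℤ x • b₁)) →
    Proper (b₁ , b₂ ⊖ fromℤ y • b₁) → y ≡ x
  translation-unique x y {b₁} {b₂} sp (-½≤m , m<½) =
    ≡.sym (ℤ.i-j≡0⇒i≡j x y (shift-unique sp (x ℤ.- y)
      (≤-respʳ-≈ (≈.sym (+-cong p≈ s≈)) (proper⇒0≤p+s {b₂ = b₂′} 0<p -½≤m))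
      (<-respʳ-≈ (≈.sym (+-cong p≈ (-‿cong s≈))) (proper⇒0<p-s {b₂ = b₂′} 0<p m<½))))
    where
    open StrictlyProper sp using (0<p)
    b₂′ : Row Carrier
    b₂′ = b₂ ⊖ fromℤ y • b₁
    g : Gram
    g = τ (fromℤ (x ℤ.- y)) (gram (b₁ , b₂ ⊖ fromℤ x • b₁))
    g≋ : g ≋ gram (b₁ , b₂′)
    g≋ = gram-shift x y b₁ b₂
    p≈ : proj₁ g ≈ b₁ · b₁
    p≈ = proj₁ g≋
    s≈ : proj₂ (proj₂ g) ≈ b₂′ · b₁ + b₂′ · b₁
    s≈ = proj₂ (proj₂ g≋)

  -- The algorithm on a basis described by a Gaussian word.

  record Runs (B : M₂ Carrier) (w : Word) : Set (c ⊔ ℓ₁ ⊔ ℓ₂) where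
    field
      output    : M₂ Carrier
      execution : Execution B w output
      unique    : ∀ {w′ R} → Execution B w′ R → w′ ≡ w

  ⊖-gram : ∀ x b₁ b₂ {h} → gram (b₁ , b₂) ≋ τ x h → gram (b₁ , b₂ ⊖ x • b₁) ≋ h
  ⊖-gram x b₁ b₂ {h} eq = begin
    gram (b₁ , b₂ ⊖ x • b₁)        ≈⟨ gram-⊖ x b₁ b₂ ⟩
    τ (- x) (gram (b₁ , b₂))       ≈⟨ τ-cong { - x} { - x} {gram (b₁ , b₂)} {τ x h} ≈.refl eq ⟩
    τ (- x) (τ x h)                ≈⟨ τ-inverse x h ⟩
    h                              ∎
    where open ≋-Reasoning

  gram-stop : ∀ {g b₁ b₂} → Base g → gram (b₁ , b₂) ≋ g → b₁ · b₁ < b₂ · b₂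
  gram-stop bg (p , q , _) = 0<y-x⇒x<y (<-respʳ-≈ (≈.sym (+-cong q (-‿cong p))) (Base.0<q-p bg))

  gram-grown : ∀ {x h b₁ b₂} → Grown x h → gram (b₁ , b₂) ≋ h → b₂ · b₂ < b₁ · b₁
  gram-grown gr (p , q , _) = 0<y-x⇒x<y (<-respʳ-≈ (≈.sym (+-cong p (-‿cong q))) (Grown.0<p-q gr))

  -- Undoing `x` leaves a strictly proper basis, so the algorithm can translate by no other integer.
  -- Whether it then stops or swaps is decided by the Gram data: `Base` has the shorter vector
  -- first, `Grown` the longer one.
  runs : ∀ {g} x xs b₁ b₂ → Base g → Gaussian xs →
    gram (b₁ , b₂) ≋ τ (fromℤ x) (form g xs) → Runs (b₁ , b₂) (T^ x ++ ∏ xs)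
  runs {g} x xs b₁ b₂ bg gauss gramB = go xs gauss gramB′
    where
    b₂′ : Row Carrier
    b₂′ = b₂ ⊖ fromℤ x • b₁

    gramB′ : gram (b₁ , b₂′) ≋ form g xs
    gramB′ = ⊖-gram (fromℤ x) b₁ b₂ gramB

    sp : StrictlyProper (gram (b₁ , b₂′))
    sp = strictlyProper-resp-≋ (≋-sym gramB′) (strictlyProper-form xs bg gauss)

    proper : Proper (b₁ , b₂′)
    proper = 0≤p+s∧0<p-s⇒proper {b₂ = b₂′} (StrictlyProper.0<p sp)
      (proj₁ (StrictlyProper.0<p+s sp)) (StrictlyProper.0<p-s sp)

    y≡x : ∀ y → Proper (b₁ , b₂ ⊖ fromℤ y • b₁) → y ≡ x
    y≡x y = translation-unique x y {b₁} {b₂} sp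

    go : ∀ xs → Gaussian xs → gram (b₁ , b₂′) ≋ form g xs → Runs (b₁ , b₂) (T^ x ++ ∏ xs)
    go [] _ eq = record
      { output    = b₁ , b₂′
      ; execution = subst (λ w → Execution (b₁ , b₂) w (b₁ , b₂′)) (≡.sym (++-identityʳ (T^ x)))
          (stop x proper (proj₁ ∣b₁∣<∣b₂′∣))
      ; unique    = unique
      }
      where
      ∣b₁∣<∣b₂′∣ : ∣ b₁ ∣ < ∣ b₂′ ∣
      ∣b₁∣<∣b₂′∣ = ∣∣-mono-< {b₁} {b₂′} (gram-stop {b₁ = b₁} {b₂′} bg eq)
      unique : ∀ {w R} → Execution (b₁ , b₂) w R → w ≡ T^ x ++ []
      unique (stop y pr _) = ≡.trans (cong T^ (y≡x y pr)) (≡.sym (++-identityʳ (T^ x)))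
      unique (swap y pr b₂′<b₁ _) = contradiction (proj₁ ∣b₁∣<∣b₂′∣)
        (<⇒≱ (subst (λ y → ∣ b₂ ⊖ fromℤ y • b₁ ∣ < ∣ b₁ ∣) (y≡x y pr) b₂′<b₁))
    go (z ∷ zs) gauss eq = record
      { output    = Runs.output rec
      ; execution = swap x proper ∣b₂′∣<∣b₁∣ (Runs.execution rec)
      ; unique    = unique
      }
      where
      rec : Runs (b₂′ , b₁) (T^ z ++ ∏ zs)
      rec = runs z zs b₂′ b₁ bg (Linked.tail gauss) (≋-trans (gram-swap b₁ b₂′) (σ-cong eq))
      ∣b₂′∣<∣b₁∣ : ∣ b₂′ ∣ < ∣ b₁ ∣
      ∣b₂′∣<∣b₁∣ = ∣∣-mono-< {b₂′} {b₁} (gram-grown {b₁ = b₁} {b₂′} (grown-form z zs bg gauss) eq)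
      unique : ∀ {w R} → Execution (b₁ , b₂) w R → w ≡ T^ x ++ ∏ (z ∷ zs)
      unique (stop y pr b₁≤b₂′) = contradiction
        (subst (λ y → ∣ b₁ ∣ ≤ ∣ b₂ ⊖ fromℤ y • b₁ ∣) (y≡x y pr) b₁≤b₂′) (<⇒≱ ∣b₂′∣<∣b₁∣)
      unique {R = R} (swap {w = w} y pr _ exec) = cong₂ (λ y w → T^ y ++ S ∷ w) (y≡x y pr)
        (Runs.unique rec (subst (λ y → Execution (b₂ ⊖ fromℤ y • b₁ , b₁) w R) (y≡x y pr) exec))

  -- From matrix values of words to their action on Gram data.

  gram-cong : ∀ {a b c d a′ b′ c′ d′} → a ≈ a′ → b ≈ b′ → c ≈ c′ → d ≈ d′ →
    gram ((a , b) , (c , d)) ≋ gram ((a′ , b′) , (c′ , d′))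
  gram-cong a b c d = +-cong (*-cong a a) (*-cong b b) , +-cong (*-cong c c) (*-cong d d)
    , +-cong (+-cong (*-cong c a) (*-cong d b)) (+-cong (*-cong c a) (*-cong d b))

  ⊛-assoc : ∀ M N R → gram ((M ⊗ N) ⊛ R) ≋ gram (M ⊛ (N ⊛ R))
  ⊛-assoc ((i , j) , (k , l)) ((a , b) , (c , d)) ((p , q) , (r , s)) =
    gram-cong (entry i j p r) (entry i j q s) (entry k l p r) (entry k l q s)
    where
    homo : ∀ i j a c → fromℤ (i ℤ.* a ℤ.+ j ℤ.* c) ≈ fromℤ i * fromℤ a + fromℤ j * fromℤ c
    homo i j a c = ≈.trans (fromℤ-+ (i ℤ.* a) (j ℤ.* c)) (+-cong (fromℤ-* i a) (fromℤ-* j c))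
    entry : ∀ i j p r → fromℤ (i ℤ.* a ℤ.+ j ℤ.* c) * p + fromℤ (i ℤ.* b ℤ.+ j ℤ.* d) * r ≈
      fromℤ i * (fromℤ a * p + fromℤ b * r) + fromℤ j * (fromℤ c * p + fromℤ d * r)
    entry i j p r = ≈.trans (+-cong (*-congʳ (homo i j a c)) (*-congʳ (homo i j b d)))
      (solve 8 (λ i j a b c d p r → (i :* a :+ j :* c) :* p :+ (i :* b :+ j :* d) :* r
        := i :* (a :* p :+ b :* r) :+ j :* (c :* p :+ d :* r)) ≈.refl
        (fromℤ i) (fromℤ j) (fromℤ a) (fromℤ b) (fromℤ c) (fromℤ d) p r)

  1x+0y≈x : ∀ x y → fromℤ 1ℤ * x + fromℤ 0ℤ * y ≈ x
  1x+0y≈x = solve 2 (λ x y → con 1ℤ :* x :+ con 0ℤ :* y := x) ≈.refl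

  0x+1y≈y : ∀ x y → fromℤ 0ℤ * x + fromℤ 1ℤ * y ≈ y
  0x+1y≈y = solve 2 (λ x y → con 0ℤ :* x :+ con 1ℤ :* y := y) ≈.refl

  gram-I₂ : ∀ B → gram (I₂ ⊛ B) ≋ gram B
  gram-I₂ ((p , q) , (r , s)) = gram-cong (1x+0y≈x p r) (1x+0y≈x q s) (0x+1y≈y p r) (0x+1y≈y q s)

  gram-letter : ∀ l B → gram (letterValue l ⊛ B) ≋ actₗ l (gram B)
  gram-letter S ((p , q) , (r , s)) = ≋-trans
    (gram-cong (0x+1y≈y p r) (0x+1y≈y q s) (1x+0y≈x p r) (1x+0y≈x q s))
    (gram-swap (p , q) (r , s))
  gram-letter T ((p , q) , (r , s)) = ≋-trans
    (gram-cong (1x+0y≈x p r) (1x+0y≈x q s) (lower p r) (lower q s))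
    (≋-trans (gram-⊖ (fromℤ -1ℤ) (p , q) (r , s)) (τ-cong (≈.sym (fromℤ-neg -1ℤ)) ≋-refl))
    where
    lower : ∀ x y → fromℤ 1ℤ * x + fromℤ 1ℤ * y ≈ y - fromℤ -1ℤ * x
    lower = solve 2 (λ x y → con 1ℤ :* x :+ con 1ℤ :* y := y :- con -1ℤ :* x) ≈.refl
  gram-letter T⁻¹ ((p , q) , (r , s)) = ≋-trans
    (gram-cong (1x+0y≈x p r) (1x+0y≈x q s) (lower p r) (lower q s))
    (gram-⊖ (fromℤ 1ℤ) (p , q) (r , s))
    where
    lower : ∀ x y → fromℤ -1ℤ * x + fromℤ 1ℤ * y ≈ y - fromℤ 1ℤ * x
    lower = solve 2 (λ x y → con -1ℤ :* x :+ con 1ℤ :* y := y :- con 1ℤ :* x) ≈.refl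

  gram-value : ∀ w R → gram (value w ⊛ R) ≋ act w (gram R)
  gram-value []      R = gram-I₂ R
  gram-value (l ∷ w) R = ≋-trans (⊛-assoc (letterValue l) (value w) R)
    (≋-trans (gram-letter l (value w ⊛ R)) (lift l))
    where
    lift : ∀ l → actₗ l (gram (value w ⊛ R)) ≋ actₗ l (act w (gram R))
    lift S   = σ-cong (gram-value w R)
    lift T   = τ-cong ≈.refl (gram-value w R)
    lift T⁻¹ = τ-cong ≈.refl (gram-value w R)

  gram-base : ∀ R → IsBasis R → Reduced R → ∣ proj₁ R ∣ < ∣ proj₂ R ∣ → ¬ (m R ≈ - ½) →
    Base (gram R)
  gram-base R@(b₁@(p , q) , b₂) basis ((-½≤m , m<½) , _) ∣b₁∣<∣b₂∣ m≉-½ = base 0<b₁²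
    (proper⇒0<p+s {b₂ = b₂} 0<b₁² (-½≤m , λ -½≈m → m≉-½ (≈.sym -½≈m)))
    (proper⇒0<p-s {b₂ = b₂} 0<b₁² m<½)
    (x<y⇒0<y-x (∣∣-cancel-< {b₁} {b₂} ∣b₁∣<∣b₂∣))
    where
    0<b₁² : 0# < b₁ · b₁
    -- If b₁ · b₁ vanished, so would both coordinates of b₁, and 1 · b₁ + 0 · b₂ = 0 would
    -- contradict independence.
    0<b₁² = 0≤v·v b₁ , λ 0≈b₁² → 0≉1 (≈.sym (proj₁ (basis 1# 0#
      (vanishes _ (≈.sym 0≈b₁²))
      (vanishes _ (≈.trans (+-comm _ _) (≈.sym 0≈b₁²))))))
      where
      summand≈0 : ∀ {x y} → x * x + y * y ≈ 0# → x ≈ 0#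
      summand≈0 {x} {y} eq with 0# ≟ x
      ... | yes 0≈x = ≈.sym 0≈x
      ... | no 0≉x = contradiction (≈.sym eq) (proj₂ (0<+0≤
        (0≤x*x x , λ 0≈xx → 0≉x (≈.sym (x*x≈0⇒x≈0 (≈.sym 0≈xx)))) (0≤x*x y)))
      vanishes : ∀ z {x y} → x * x + y * y ≈ 0# → 1# * x + 0# * z ≈ 0#
      vanishes z eq = ≈.trans
        (+-cong (≈.trans (*-identityˡ _) (summand≈0 eq)) (zeroˡ z)) (+-identityˡ 0#)

  determined : ∀ {ω g B} x xs → Base g → gram B ≋ act ω g → Gaussian xs →
    Star _⟶_ ω (T^ x ++ ∏ xs) → Runs B (T^ x ++ ∏ xs)
  determined {B = b₁ , b₂} x xs bg gramB gauss steps with ⟶*⇒⊑ steps _ bg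
  ... | g′ , bg′ , eq = runs x xs b₁ b₂ bg′ gauss
    (≋-trans gramB (≋-trans eq (act-T^∏ x xs g′)))

-- The word reached has the Gaussian shape, but nothing here says that it is irreducible; that
-- follows later from the uniqueness of the recorded word.
normalise : ∀ ω → ∃₂ λ x xs → Gaussian xs × Star _⟶_ ω (T^ x ++ ∏ xs)
normalise ω = go ω (⟶-wellFounded ω)
  where
  go : ∀ ω → Acc (flip _⟶_) ω → ∃₂ λ x xs → Gaussian xs × Star _⟶_ ω (T^ x ++ ∏ xs)
  go ω (acc rec) with progress ω
  ... | inj₂ (x , xs , gauss , ≡.refl) = x , xs , gauss , ε
  ... | inj₁ (ω′ , step) with go ω′ (rec step)
  ...   | x , xs , gauss , steps = x , xs , gauss , step ◅ steps

⟶*-weight : ∀ {w w′} → Star _⟶_ w w′ → weight w′ ℕ.≤ weight w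
⟶*-weight ε              = ℕ.≤-refl
⟶*-weight (step ◅ steps) = ℕ.≤-trans (⟶*-weight steps) (ℕ.<⇒≤ (proj₂ (⟶⇒⊏ step)))

theorem1 : ∀ {c ℓ₁ ℓ₂} (F : ArchimedeanEuclideanField c ℓ₁ ℓ₂) →
    let open ArchimedeanEuclideanField F
        open Lattice F in
    (R : M₂ Carrier) → IsBasis R → Reduced R →
    ∣ proj₁ R ∣ < ∣ proj₂ R ∣ →
    ¬ (m R ≈ - ½) →
    (U : M₂ ℤ) → U ∈GL₂ℤ →
    (ω₁ : Word) → value ω₁ ≡ U →
    (∃ λ γ → IsGaussianDecomposition R U γ) ×
    (∀ γ → IsGaussianDecomposition R U γ → ω₁ RewritesTo γ)
theorem1 F R basis red b₁<b₂ m≉-½ U _ ω₁ ≡.refl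
  with x , xs , gauss , steps ← normalise ω₁
  = (γ₀ , Runs.output run₀ , Runs.execution run₀)
  , λ γ exec → subst (ω₁ RewritesTo_) (≡.sym (Runs.unique run₀ (proj₂ exec))) rewritesTo
  where
  open GramForms F
  open Lattice F using (_⊛_)
  γ₀ : Word
  γ₀ = T^ x ++ ∏ xs
  run : ∀ x xs → Gaussian xs → Star _⟶_ ω₁ (T^ x ++ ∏ xs) → Runs (value ω₁ ⊛ R) (T^ x ++ ∏ xs)
  run x xs = determined x xs (gram-base R basis red b₁<b₂ m≉-½) (gram-value ω₁ R)
  run₀ : Runs (value ω₁ ⊛ R) γ₀
  run₀ = run x xs gauss steps
  -- Different reductions may end over Gram data that differ by `conj`, yet both words are recorded
  -- on the same input basis `value ω₁ ⊛ R`, so determinism identifies them.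
  unique : ∀ x xs → Gaussian xs → Star _⟶_ ω₁ (T^ x ++ ∏ xs) → T^ x ++ ∏ xs ≡ γ₀
  unique x xs gauss steps = Runs.unique run₀ (Runs.execution (run x xs gauss steps))
  rewritesTo : ω₁ RewritesTo γ₀
  rewritesTo = record
    { terminates = ⟶-wellFounded ω₁
    ; reaches    = steps
    -- A step from γ₀ would lead back to γ₀, at a smaller weight.
    ; reduced    = λ (w , step) → let y , ys , gauss′ , steps′ = normalise w in
        ℕ.<⇒≱ (proj₂ (⟶⇒⊏ step)) (subst (λ v → weight v ℕ.≤ weight w)
          (unique y ys gauss′ (steps ◅◅ step ◅ steps′)) (⟶*-weight steps′))
    ; unique     = unique′
    }
    where
    unique′ : ∀ {w} → Star _⟶_ ω₁ w → IsNormalForm _⟶_ w → w ≡ γ₀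
    unique′ {w} steps′ nf with progress w
    ... | inj₁ step                       = contradiction step nf
    ... | inj₂ (y , ys , gauss′ , ≡.refl) = unique y ys gauss′ steps′
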